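{- ${\sf RCA}_0$ proves that ${\sf SRT}^2_2$ implies ${\sf ERT}$.
   Context: ${\sf RCA}_0$ is the base system of second order arithmetic. ${\sf SRT}^2_2$ (stable Ramsey's theorem for pairs and two colors) asserts: for every $g:[\mathbb{N}]^2\to 2$ that is stable (i.e. for each $a$, $\lim_{b\to\infty} g(a,b)$ exists), there is an infinite set $H\subseteq\mathbb{N}$ on which $g$ is constant on $[H]^2$. ${\sf ERT}$ (eventually repeating tails) asserts: for every $k\in\mathbb{N}$ and every $f:\mathbb{N}\to k$, there is $b\in\mathbb{N}$ such that for all $x\ge b$ there is $y\ge b$ with $x\ne y$ and $f(x)=f(y)$. -}

module Defs where

-- A syntactic rendering of second-order arithmetic (the language L_2 of
-- Simpson, "Subsystems of Second Order Arithmetic"), a classical natural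
-- deduction calculus for it, the axioms of RCA₀, and the L_2-sentences
-- SRT²₂ and ERT.  "RCA₀ proves φ" is rendered as  RCA₀ ⊢ φ.
-- Variables are de Bruijn indices; number variables and set variables are
-- two separate sorts with separate index spaces.

open import Data.Nat using (ℕ; zero; suc; _<ᵇ_; _≡ᵇ_; pred)
open import Data.Bool using (Bool; true; false; if_then_else_)
open import Data.List using (List; []; _∷_; map)
open import Data.List.Membership.Propositional using (_∈_)

infixl 7 _*ᵗ_
infixl 6 _+ᵗ_
infix  4 _≐_ _<ᵗ_ _∈ˢ_ _≤ᵗ_
infixr 3 _∧_
infixr 2 _∨_
infixr 1 _⇒_ _⇔_

data Term : Set where
  v     : ℕ → Term
  zero' : Term
  one'  : Term
  _+ᵗ_  : Term → Term → Term
  _*ᵗ_  : Term → Term → Term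

data Formula : Set where
  _≐_  : Term → Term → Formula
  _<ᵗ_ : Term → Term → Formula
  _∈ˢ_ : Term → ℕ → Formula
  ⊥'   : Formula
  _⇒_  : Formula → Formula → Formula
  ∀ⁿ   : Formula → Formula
  ∀ˢ   : Formula → Formula

¬' : Formula → Formula
¬' φ = φ ⇒ ⊥'

_∧_ : Formula → Formula → Formula
φ ∧ ψ = ¬' (φ ⇒ ¬' ψ)

_∨_ : Formula → Formula → Formula
φ ∨ ψ = ¬' φ ⇒ ψ

_⇔_ : Formula → Formula → Formula
φ ⇔ ψ = (φ ⇒ ψ) ∧ (ψ ⇒ φ)

∃ⁿ : Formula → Formula
∃ⁿ φ = ¬' (∀ⁿ (¬' φ))

∃ˢ : Formula → Formula
∃ˢ φ = ¬' (∀ˢ (¬' φ))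

_≤ᵗ_ : Term → Term → Formula
t ≤ᵗ u = (t <ᵗ u) ∨ (t ≐ u)

num : ℕ → Term
num zero    = zero'
num (suc n) = num n +ᵗ one'

-- Cantor pairing (i,j) = (i+j)² + i, as in Simpson II.2
⟨_,_⟩ : Term → Term → Term
⟨ t , u ⟩ = (t +ᵗ u) *ᵗ (t +ᵗ u) +ᵗ t

shiftIdx : ℕ → ℕ → ℕ
shiftIdx c i = if i <ᵇ c then i else suc i

substIdx : {A : Set} → (ℕ → A) → ℕ → A → ℕ → A
substIdx var k r i =
  if i ≡ᵇ k then r else (if k <ᵇ i then var (pred i) else var i)

shiftT : ℕ → Term → Term
shiftT c (v i)      = v (shiftIdx c i)
shiftT c zero'      = zero'
shiftT c one'       = one'
shiftT c (t +ᵗ u)   = shiftT c t +ᵗ shiftT c u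
shiftT c (t *ᵗ u)   = shiftT c t *ᵗ shiftT c u

substT : ℕ → Term → Term → Term
substT k r (v i)    = substIdx v k r i
substT k r zero'    = zero'
substT k r one'     = one'
substT k r (t +ᵗ u) = substT k r t +ᵗ substT k r u
substT k r (t *ᵗ u) = substT k r t *ᵗ substT k r u

shiftN : ℕ → Formula → Formula
shiftN c (t ≐ u)   = shiftT c t ≐ shiftT c u
shiftN c (t <ᵗ u)  = shiftT c t <ᵗ shiftT c u
shiftN c (t ∈ˢ X)  = shiftT c t ∈ˢ X
shiftN c ⊥'        = ⊥'
shiftN c (φ ⇒ ψ)   = shiftN c φ ⇒ shiftN c ψ
shiftN c (∀ⁿ φ)    = ∀ⁿ (shiftN (suc c) φ)
shiftN c (∀ˢ φ)    = ∀ˢ (shiftN c φ)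

substN : ℕ → Term → Formula → Formula
substN k r (t ≐ u)  = substT k r t ≐ substT k r u
substN k r (t <ᵗ u) = substT k r t <ᵗ substT k r u
substN k r (t ∈ˢ X) = substT k r t ∈ˢ X
substN k r ⊥'       = ⊥'
substN k r (φ ⇒ ψ)  = substN k r φ ⇒ substN k r ψ
substN k r (∀ⁿ φ)   = ∀ⁿ (substN (suc k) (shiftT 0 r) φ)
substN k r (∀ˢ φ)   = ∀ˢ (substN k r φ)

shiftS : ℕ → Formula → Formula
shiftS c (t ≐ u)   = t ≐ u
shiftS c (t <ᵗ u)  = t <ᵗ u
shiftS c (t ∈ˢ X)  = t ∈ˢ shiftIdx c X
shiftS c ⊥'        = ⊥'
shiftS c (φ ⇒ ψ)   = shiftS c φ ⇒ shiftS c ψ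
shiftS c (∀ⁿ φ)    = ∀ⁿ (shiftS c φ)
shiftS c (∀ˢ φ)    = ∀ˢ (shiftS (suc c) φ)

substS : ℕ → ℕ → Formula → Formula
substS k Y (t ≐ u)  = t ≐ u
substS k Y (t <ᵗ u) = t <ᵗ u
substS k Y (t ∈ˢ X) = t ∈ˢ substIdx (λ i → i) k Y X
substS k Y ⊥'       = ⊥'
substS k Y (φ ⇒ ψ)  = substS k Y φ ⇒ substS k Y ψ
substS k Y (∀ⁿ φ)   = ∀ⁿ (substS k Y φ)
substS k Y (∀ˢ φ)   = ∀ˢ (substS (suc k) (suc Y) φ)

-- bounded (Σ⁰₀) formulas: no set quantifiers, only bounded number
-- quantifiers ∀n (n < t → θ) with n not occurring in t
data Σ⁰₀ : Formula → Set where
  eq   : ∀ t u → Σ⁰₀ (t ≐ u)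
  lt   : ∀ t u → Σ⁰₀ (t <ᵗ u)
  mem  : ∀ t X → Σ⁰₀ (t ∈ˢ X)
  bot  : Σ⁰₀ ⊥'
  imp  : ∀ {φ ψ} → Σ⁰₀ φ → Σ⁰₀ ψ → Σ⁰₀ (φ ⇒ ψ)
  ball : ∀ {θ} t → Σ⁰₀ θ → Σ⁰₀ (∀ⁿ ((v 0 <ᵗ shiftT 0 t) ⇒ θ))

data Σ⁰₁ : Formula → Set where
  σ : ∀ {θ} → Σ⁰₀ θ → Σ⁰₁ (∃ⁿ θ)

data Π⁰₁ : Formula → Set where
  π : ∀ {θ} → Σ⁰₀ θ → Π⁰₁ (∀ⁿ θ)

-- Axioms of RCA₀ (Simpson I.7 / II.1).  Free variables act as parameters
-- (implicitly universally quantified).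

succInst : Formula → Formula
succInst φ = substN 0 (v 0 +ᵗ one') (shiftN 1 φ)

data AxRCA₀ : Formula → Set where
  ax1 : AxRCA₀ (¬' (v 0 +ᵗ one' ≐ zero'))
  ax2 : AxRCA₀ ((v 0 +ᵗ one' ≐ v 1 +ᵗ one') ⇒ (v 0 ≐ v 1))
  ax3 : AxRCA₀ (v 0 +ᵗ zero' ≐ v 0)
  ax4 : AxRCA₀ (v 0 +ᵗ (v 1 +ᵗ one') ≐ (v 0 +ᵗ v 1) +ᵗ one')
  ax5 : AxRCA₀ (v 0 *ᵗ zero' ≐ zero')
  ax6 : AxRCA₀ (v 0 *ᵗ (v 1 +ᵗ one') ≐ (v 0 *ᵗ v 1) +ᵗ v 0)
  ax7 : AxRCA₀ (¬' (v 0 <ᵗ zero'))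
  ax8 : AxRCA₀ ((v 0 <ᵗ v 1 +ᵗ one') ⇔ ((v 0 <ᵗ v 1) ∨ (v 0 ≐ v 1)))
  ind : ∀ {φ} → Σ⁰₁ φ →
        AxRCA₀ ((substN 0 zero' φ ∧ ∀ⁿ (φ ⇒ succInst φ)) ⇒ ∀ⁿ φ)
  -- Δ⁰₁ comprehension (X not free in φ, ensured by shiftS)
  comp : ∀ {φ ψ} → Σ⁰₁ φ → Π⁰₁ ψ →
         AxRCA₀ (∀ⁿ (φ ⇔ ψ) ⇒ ∃ˢ (∀ⁿ ((v 0 ∈ˢ 0) ⇔ shiftS 0 φ)))

infix 0 _⊢_
data _⊢_ (Γ : List Formula) : Formula → Set where
  hyp   : ∀ {φ} → φ ∈ Γ → Γ ⊢ φ
  ax    : ∀ {φ} → AxRCA₀ φ → Γ ⊢ φ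
  ⇒I    : ∀ {φ ψ} → (φ ∷ Γ) ⊢ ψ → Γ ⊢ φ ⇒ ψ
  ⇒E    : ∀ {φ ψ} → Γ ⊢ φ ⇒ ψ → Γ ⊢ φ → Γ ⊢ ψ
  raa   : ∀ {φ} → (¬' φ ∷ Γ) ⊢ ⊥' → Γ ⊢ φ
  ∀ⁿI   : ∀ {φ} → map (shiftN 0) Γ ⊢ φ → Γ ⊢ ∀ⁿ φ
  ∀ⁿE   : ∀ {φ} → Γ ⊢ ∀ⁿ φ → (t : Term) → Γ ⊢ substN 0 t φ
  ∀ˢI   : ∀ {φ} → map (shiftS 0) Γ ⊢ φ → Γ ⊢ ∀ˢ φ
  ∀ˢE   : ∀ {φ} → Γ ⊢ ∀ˢ φ → (Y : ℕ) → Γ ⊢ substS 0 Y φ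
  ≐refl : ∀ t → Γ ⊢ t ≐ t
  ≐subst : ∀ {t u φ} → Γ ⊢ t ≐ u → Γ ⊢ substN 0 t φ → Γ ⊢ substN 0 u φ

RCA₀⊢ : Formula → Set
RCA₀⊢ φ = [] ⊢ φ

-- SRT²₂ as an L_2 sentence.
-- A colouring g : [ℕ]² → 2 is coded by a set G with
--   ((a,b),c) ∈ G  meaning  g(a,b) = c   (for a < b).

Colouring2 : Formula
Colouring2 =
  ∀ⁿ (∀ⁿ ((v 1 <ᵗ v 0) ⇒ ∃ⁿ ((v 0 <ᵗ num 2) ∧ (⟨ ⟨ v 2 , v 1 ⟩ , v 0 ⟩ ∈ˢ 0))))
  ∧ ∀ⁿ (∀ⁿ (∀ⁿ (∀ⁿ (((⟨ ⟨ v 3 , v 2 ⟩ , v 1 ⟩ ∈ˢ 0) ∧ (⟨ ⟨ v 3 , v 2 ⟩ , v 0 ⟩ ∈ˢ 0))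
                     ⇒ (v 1 ≐ v 0)))))

Stable : Formula
Stable = ∀ⁿ (∃ⁿ (∃ⁿ (∀ⁿ (((v 1 <ᵗ v 0) ∧ (v 3 <ᵗ v 0))
                         ⇒ (⟨ ⟨ v 3 , v 0 ⟩ , v 2 ⟩ ∈ˢ 0)))))

Infinite : Formula
Infinite = ∀ⁿ (∃ⁿ ((v 1 <ᵗ v 0) ∧ (v 0 ∈ˢ 0)))

-- ∃c < 2 ∀a ∀b ((a ∈ H ∧ b ∈ H ∧ a < b) → g(a,b) = c)
-- (H = set var 0, G = set var 1)
Homogeneous : Formula
Homogeneous =
  ∃ⁿ ((v 0 <ᵗ num 2) ∧
      ∀ⁿ (∀ⁿ (((v 1 ∈ˢ 0) ∧ (v 0 ∈ˢ 0) ∧ (v 1 <ᵗ v 0))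
              ⇒ (⟨ ⟨ v 1 , v 0 ⟩ , v 2 ⟩ ∈ˢ 1))))

SRT²₂ : Formula
SRT²₂ = ∀ˢ ((Colouring2 ∧ Stable) ⇒ ∃ˢ (Infinite ∧ Homogeneous))

-- ERT as an L_2 sentence.
-- f : ℕ → k is coded by a set F with (x,y) ∈ F meaning f(x) = y,
-- where k = {0,…,k-1}.

-- (k = number var 0, F = set var 0)
FunctionTo : Formula
FunctionTo =
  ∀ⁿ (∃ⁿ ((v 0 <ᵗ v 2) ∧ (⟨ v 1 , v 0 ⟩ ∈ˢ 0)))
  ∧ ∀ⁿ (∀ⁿ (∀ⁿ (((⟨ v 2 , v 1 ⟩ ∈ˢ 0) ∧ (⟨ v 2 , v 0 ⟩ ∈ˢ 0)) ⇒ (v 1 ≐ v 0))))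

RepeatingTail : Formula
RepeatingTail =
  ∃ⁿ (∀ⁿ ((v 1 ≤ᵗ v 0) ⇒
     ∃ⁿ ((v 2 ≤ᵗ v 0) ∧ ¬' (v 1 ≐ v 0) ∧
         ∃ⁿ ((⟨ v 2 , v 0 ⟩ ∈ˢ 0) ∧ (⟨ v 1 , v 0 ⟩ ∈ˢ 0)))))

ERT : Formula
ERT = ∀ⁿ (∀ˢ (FunctionTo ⇒ RepeatingTail))

{-# OPTIONS --safe #-}
module Submission where

-- Let f : ℕ → k be a counterexample to ERT.  Colour a pair a < b with 1 if some colour of f
-- occurs exactly once in [a, b), and with 0 otherwise.  Since f has no repeating tail, every a
-- has an x whose colour occurs in [a, ∞) only at x, so the colouring is stable with limit 1,
-- and SRT²₂ yields an infinite H such that for all a < b in H some colour is unique in [a, b).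
-- Code sets of colours by products of pairwise coprime numbers d₀, …, d₍ₖ₋₁₎ ≥ 2.  If
-- h₀ < … < hₗ are in H and q codes a set containing all colours of [h₀, hₗ), then l < q:
-- deleting the colour e that is unique in [h₀, hₗ) gives q′ = q / dₑ ≤ q / 2, and cutting at
-- the index q′ leaves a half with at least q′ steps that misses e.  As q may be taken
-- to code the set of all colours, H cannot be infinite.

open import Defs
open import Level using (0ℓ)
open import Data.Nat using (ℕ; zero; suc; _<ᵇ_; _≡ᵇ_; pred; _⊔_; _≤_; _<_; s≤s; z≤n)
open import Data.Nat.Properties using (≤-trans; m≤m⊔n; m≤n⊔m; n≤1+n)
open import Data.Bool using (Bool; true; false; if_then_else_; T) renaming (_∧_ to _and_)
open import Data.Bool.Properties using (T-∧)
open import Data.Maybe using (Maybe; just; nothing; is-just; zipWith)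
open import Data.List using (List; []; _∷_; map; foldr; drop)
open import Data.List.Membership.Propositional.Properties using (∈-map⁺)
open import Data.List.Relation.Unary.Any using (here; there)
open import Data.List.Relation.Binary.Subset.Propositional using (_⊆_)
open import Data.List.Relation.Binary.Subset.Propositional.Properties using (∷⁺ʳ; map⁺)
open import Data.Product using (_,_)
open import Function using (_∘_; Equivalence)
open import Algebra.Bundles using (CommutativeSemiring)
open import Algebra.Structures.Biased using (isCommutativeSemiringˡ)
import Algebra.Solver.Ring.NaturalCoefficients.Default as NaturalCoefficients
open import Relation.Binary.Structures using (IsEquivalence)
open import Relation.Binary.PropositionalEquality using (_≡_; refl; sym; trans; cong; cong₂; subst; subst₂; _≗_; module ≡-Reasoning)

-- Only Σ⁰₁ induction is available, and this shapes both halves of the argument. Counting the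
-- colours of an interval would bound the sequence by a power of 2 and call for coded cardinalities
-- and exponentials; the code q serves as its own bound instead, because dividing out a modulus at
-- least halves it. The induction on q must moreover be over a bounded formula, so it speaks of a
-- finite increasing sequence from H coded by a single number, and never quantifies over H itself.
-- On the syntactic side, derivations are written with Agda functions as binders: a universal
-- statement is introduced from a family of derivations indexed by all terms. Justifying this is the
-- purpose of the substitution lemma for derivations.

private variable
  Γ Δ : List Formula
  φ ψ χ θ : Formula
  ts : List Term

-- Parallel substitution

Sub : Set
Sub = ℕ → Term

subT : Sub → Term → Term
subT ς (v i)    = ς i
subT ς zero'    = zero'
subT ς one'     = one'
subT ς (t +ᵗ u) = subT ς t +ᵗ subT ς u
subT ς (t *ᵗ u) = subT ς t *ᵗ subT ς u

lift : Sub → Sub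
lift ς zero    = v 0
lift ς (suc i) = shiftT 0 (ς i)

subF : Sub → Formula → Formula
subF ς (t ≐ u)  = subT ς t ≐ subT ς u
subF ς (t <ᵗ u) = subT ς t <ᵗ subT ς u
subF ς (t ∈ˢ X) = subT ς t ∈ˢ X
subF ς ⊥'       = ⊥'
subF ς (φ ⇒ ψ)  = subF ς φ ⇒ subF ς ψ
subF ς (∀ⁿ φ)   = ∀ⁿ (subF (lift ς) φ)
subF ς (∀ˢ φ)   = ∀ˢ (subF ς φ)

subT-cong : ∀ {ς τ} → ς ≗ τ → subT ς ≗ subT τ
subT-cong e (v i)    = e i
subT-cong e zero'    = refl
subT-cong e one'     = refl
subT-cong e (t +ᵗ u) = cong₂ _+ᵗ_ (subT-cong e t) (subT-cong e u)
subT-cong e (t *ᵗ u) = cong₂ _*ᵗ_ (subT-cong e t) (subT-cong e u)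

subT-∘ : ∀ ς τ t → subT ς (subT τ t) ≡ subT (subT ς ∘ τ) t
subT-∘ ς τ (v i)    = refl
subT-∘ ς τ zero'    = refl
subT-∘ ς τ one'     = refl
subT-∘ ς τ (t +ᵗ u) = cong₂ _+ᵗ_ (subT-∘ ς τ t) (subT-∘ ς τ u)
subT-∘ ς τ (t *ᵗ u) = cong₂ _*ᵗ_ (subT-∘ ς τ t) (subT-∘ ς τ u)

subT-id : ∀ t → subT v t ≡ t
subT-id (v i)    = refl
subT-id zero'    = refl
subT-id one'     = refl
subT-id (t +ᵗ u) = cong₂ _+ᵗ_ (subT-id t) (subT-id u)
subT-id (t *ᵗ u) = cong₂ _*ᵗ_ (subT-id t) (subT-id u)

shiftT-sub : ∀ c t → shiftT c t ≡ subT (v ∘ shiftIdx c) t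
shiftT-sub c (v i)    = refl
shiftT-sub c zero'    = refl
shiftT-sub c one'     = refl
shiftT-sub c (t +ᵗ u) = cong₂ _+ᵗ_ (shiftT-sub c t) (shiftT-sub c u)
shiftT-sub c (t *ᵗ u) = cong₂ _*ᵗ_ (shiftT-sub c t) (shiftT-sub c u)

substT-sub : ∀ k r t → substT k r t ≡ subT (substIdx v k r) t
substT-sub k r (v i)    = refl
substT-sub k r zero'    = refl
substT-sub k r one'     = refl
substT-sub k r (t +ᵗ u) = cong₂ _+ᵗ_ (substT-sub k r t) (substT-sub k r u)
substT-sub k r (t *ᵗ u) = cong₂ _*ᵗ_ (substT-sub k r t) (substT-sub k r u)

subT-shiftT : ∀ ς t → subT ς (shiftT 0 t) ≡ subT (ς ∘ suc) t
subT-shiftT ς t = trans (cong (subT ς) (shiftT-sub 0 t)) (subT-∘ ς (v ∘ shiftIdx 0) t)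

lift-shiftT : ∀ ς t → subT (lift ς) (shiftT 0 t) ≡ shiftT 0 (subT ς t)
lift-shiftT ς t = begin
  subT (lift ς) (shiftT 0 t)             ≡⟨ subT-shiftT (lift ς) t ⟩
  subT (shiftT 0 ∘ ς) t                  ≡⟨ subT-cong (shiftT-sub 0 ∘ ς) t ⟩
  subT (subT (v ∘ shiftIdx 0) ∘ ς) t     ≡⟨ sym (subT-∘ (v ∘ shiftIdx 0) ς t) ⟩
  subT (v ∘ shiftIdx 0) (subT ς t)       ≡⟨ sym (shiftT-sub 0 (subT ς t)) ⟩
  shiftT 0 (subT ς t)                    ∎
  where open ≡-Reasoning

lift-cong : ∀ {ς τ} → ς ≗ τ → lift ς ≗ lift τ
lift-cong e zero    = refl
lift-cong e (suc i) = cong (shiftT 0) (e i)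

lift-∘ : ∀ ς τ → subT (lift ς) ∘ lift τ ≗ lift (subT ς ∘ τ)
lift-∘ ς τ zero    = refl
lift-∘ ς τ (suc i) = lift-shiftT ς (τ i)

lift-id : lift v ≗ v
lift-id zero    = refl
lift-id (suc i) = refl

lift-shiftIdx : ∀ c → lift (v ∘ shiftIdx c) ≗ v ∘ shiftIdx (suc c)
lift-shiftIdx c zero = refl
lift-shiftIdx c (suc i) with i <ᵇ c
... | true  = refl
... | false = refl

lift-substIdx : ∀ k r → lift (substIdx v k r) ≗ substIdx v (suc k) (shiftT 0 r)
lift-substIdx k r zero = refl
lift-substIdx k r (suc i) with i ≡ᵇ k
... | true = refl
... | false = go i
  where
  go : ∀ j → shiftT 0 (if k <ᵇ j then v (pred j) else v j)
             ≡ (if k <ᵇ j then v j else v (suc j))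
  go zero = refl
  go (suc j) with k <ᵇ suc j
  ... | true  = refl
  ... | false = refl

subF-cong : ∀ {ς τ} → ς ≗ τ → subF ς ≗ subF τ
subF-cong e (t ≐ u)  = cong₂ _≐_ (subT-cong e t) (subT-cong e u)
subF-cong e (t <ᵗ u) = cong₂ _<ᵗ_ (subT-cong e t) (subT-cong e u)
subF-cong e (t ∈ˢ X) = cong (_∈ˢ X) (subT-cong e t)
subF-cong e ⊥'       = refl
subF-cong e (φ ⇒ ψ)  = cong₂ _⇒_ (subF-cong e φ) (subF-cong e ψ)
subF-cong e (∀ⁿ φ)   = cong ∀ⁿ (subF-cong (lift-cong e) φ)
subF-cong e (∀ˢ φ)   = cong ∀ˢ (subF-cong e φ)

subF-∘ : ∀ ς τ φ → subF ς (subF τ φ) ≡ subF (subT ς ∘ τ) φ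
subF-∘ ς τ (t ≐ u)  = cong₂ _≐_ (subT-∘ ς τ t) (subT-∘ ς τ u)
subF-∘ ς τ (t <ᵗ u) = cong₂ _<ᵗ_ (subT-∘ ς τ t) (subT-∘ ς τ u)
subF-∘ ς τ (t ∈ˢ X) = cong (_∈ˢ X) (subT-∘ ς τ t)
subF-∘ ς τ ⊥'       = refl
subF-∘ ς τ (φ ⇒ ψ)  = cong₂ _⇒_ (subF-∘ ς τ φ) (subF-∘ ς τ ψ)
subF-∘ ς τ (∀ⁿ φ)   = cong ∀ⁿ (trans (subF-∘ (lift ς) (lift τ) φ) (subF-cong (lift-∘ ς τ) φ))
subF-∘ ς τ (∀ˢ φ)   = cong ∀ˢ (subF-∘ ς τ φ)

subF-id : ∀ φ → subF v φ ≡ φ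
subF-id (t ≐ u)  = cong₂ _≐_ (subT-id t) (subT-id u)
subF-id (t <ᵗ u) = cong₂ _<ᵗ_ (subT-id t) (subT-id u)
subF-id (t ∈ˢ X) = cong (_∈ˢ X) (subT-id t)
subF-id ⊥'       = refl
subF-id (φ ⇒ ψ)  = cong₂ _⇒_ (subF-id φ) (subF-id ψ)
subF-id (∀ⁿ φ)   = cong ∀ⁿ (trans (subF-cong lift-id φ) (subF-id φ))
subF-id (∀ˢ φ)   = cong ∀ˢ (subF-id φ)

shiftN-sub : ∀ c φ → shiftN c φ ≡ subF (v ∘ shiftIdx c) φ
shiftN-sub c (t ≐ u)  = cong₂ _≐_ (shiftT-sub c t) (shiftT-sub c u)
shiftN-sub c (t <ᵗ u) = cong₂ _<ᵗ_ (shiftT-sub c t) (shiftT-sub c u)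
shiftN-sub c (t ∈ˢ X) = cong (_∈ˢ X) (shiftT-sub c t)
shiftN-sub c ⊥'       = refl
shiftN-sub c (φ ⇒ ψ)  = cong₂ _⇒_ (shiftN-sub c φ) (shiftN-sub c ψ)
shiftN-sub c (∀ⁿ φ)   =
  cong ∀ⁿ (trans (shiftN-sub (suc c) φ) (sym (subF-cong (lift-shiftIdx c) φ)))
shiftN-sub c (∀ˢ φ)   = cong ∀ˢ (shiftN-sub c φ)

substN-sub : ∀ k r φ → substN k r φ ≡ subF (substIdx v k r) φ
substN-sub k r (t ≐ u)  = cong₂ _≐_ (substT-sub k r t) (substT-sub k r u)
substN-sub k r (t <ᵗ u) = cong₂ _<ᵗ_ (substT-sub k r t) (substT-sub k r u)
substN-sub k r (t ∈ˢ X) = cong (_∈ˢ X) (substT-sub k r t)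
substN-sub k r ⊥'       = refl
substN-sub k r (φ ⇒ ψ)  = cong₂ _⇒_ (substN-sub k r φ) (substN-sub k r ψ)
substN-sub k r (∀ⁿ φ)   =
  cong ∀ⁿ (trans (substN-sub (suc k) (shiftT 0 r) φ) (sym (subF-cong (lift-substIdx k r) φ)))
substN-sub k r (∀ˢ φ)   = cong ∀ˢ (substN-sub k r φ)

infixr 5 _•_
_•_ : Term → Sub → Sub
(t • ς) zero    = t
(t • ς) (suc i) = ς i

substN-lift : ∀ t ς φ → substN 0 t (subF (lift ς) φ) ≡ subF (t • ς) φ
substN-lift t ς φ = begin
  substN 0 t (subF (lift ς) φ)                 ≡⟨ substN-sub 0 t _ ⟩
  subF (substIdx v 0 t) (subF (lift ς) φ)      ≡⟨ subF-∘ _ _ φ ⟩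
  subF (subT (substIdx v 0 t) ∘ lift ς) φ      ≡⟨ subF-cong pointwise φ ⟩
  subF (t • ς) φ                               ∎
  where
  open ≡-Reasoning
  pointwise : subT (substIdx v 0 t) ∘ lift ς ≗ t • ς
  pointwise zero    = refl
  pointwise (suc i) = trans (subT-shiftT (substIdx v 0 t) (ς i)) (subT-id (ς i))

subF-substN : ∀ ς t φ → subF ς (substN 0 t φ) ≡ substN 0 (subT ς t) (subF (lift ς) φ)
subF-substN ς t φ = begin
  subF ς (substN 0 t φ)                    ≡⟨ cong (subF ς) (substN-sub 0 t φ) ⟩
  subF ς (subF (substIdx v 0 t) φ)         ≡⟨ subF-∘ _ _ φ ⟩
  subF (subT ς ∘ substIdx v 0 t) φ         ≡⟨ subF-cong pointwise φ ⟩
  subF (subT ς t • ς) φ                    ≡⟨ sym (substN-lift (subT ς t) ς φ) ⟩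
  substN 0 (subT ς t) (subF (lift ς) φ)    ∎
  where
  open ≡-Reasoning
  pointwise : subT ς ∘ substIdx v 0 t ≗ subT ς t • ς
  pointwise zero    = refl
  pointwise (suc i) = refl

subF-shiftN : ∀ ς φ → subF (lift ς) (shiftN 0 φ) ≡ shiftN 0 (subF ς φ)
subF-shiftN ς φ = begin
  subF (lift ς) (shiftN 0 φ)                   ≡⟨ cong (subF (lift ς)) (shiftN-sub 0 φ) ⟩
  subF (lift ς) (subF (v ∘ shiftIdx 0) φ)      ≡⟨ subF-∘ _ _ φ ⟩
  subF (shiftT 0 ∘ ς) φ                        ≡⟨ subF-cong (shiftT-sub 0 ∘ ς) φ ⟩
  subF (subT (v ∘ shiftIdx 0) ∘ ς) φ           ≡⟨ sym (subF-∘ _ _ φ) ⟩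
  subF (v ∘ shiftIdx 0) (subF ς φ)             ≡⟨ sym (shiftN-sub 0 (subF ς φ)) ⟩
  shiftN 0 (subF ς φ)                          ∎
  where open ≡-Reasoning

succInst-sub : ∀ φ → succInst φ ≡ subF ((v 0 +ᵗ one') • v ∘ suc) φ
succInst-sub φ = begin
  succInst φ                                                    ≡⟨ substN-sub 0 _ (shiftN 1 φ) ⟩
  subF (substIdx v 0 (v 0 +ᵗ one')) (shiftN 1 φ)                ≡⟨ cong (subF _) (shiftN-sub 1 φ) ⟩
  subF (substIdx v 0 (v 0 +ᵗ one')) (subF (v ∘ shiftIdx 1) φ)   ≡⟨ subF-∘ _ _ φ ⟩
  subF (substIdx v 0 (v 0 +ᵗ one') ∘ shiftIdx 1) φ              ≡⟨ subF-cong pointwise φ ⟩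
  subF ((v 0 +ᵗ one') • v ∘ suc) φ                              ∎
  where
  open ≡-Reasoning
  pointwise : substIdx v 0 (v 0 +ᵗ one') ∘ shiftIdx 1 ≗ (v 0 +ᵗ one') • v ∘ suc
  pointwise zero    = refl
  pointwise (suc i) = refl

subF-succInst : ∀ ς φ → subF (lift ς) (succInst φ) ≡ succInst (subF (lift ς) φ)
subF-succInst ς φ = begin
  subF (lift ς) (succInst φ)                        ≡⟨ cong (subF (lift ς)) (succInst-sub φ) ⟩
  subF (lift ς) (subF s φ)                          ≡⟨ subF-∘ _ _ φ ⟩
  subF (subT (lift ς) ∘ s) φ                        ≡⟨ subF-cong pointwise φ ⟩
  subF (subT s ∘ lift ς) φ                          ≡⟨ sym (subF-∘ _ _ φ) ⟩
  subF s (subF (lift ς) φ)                          ≡⟨ sym (succInst-sub (subF (lift ς) φ)) ⟩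
  succInst (subF (lift ς) φ)                        ∎
  where
  open ≡-Reasoning
  s : Sub
  s = (v 0 +ᵗ one') • v ∘ suc
  pointwise : subT (lift ς) ∘ s ≗ subT s ∘ lift ς
  pointwise zero    = refl
  pointwise (suc i) = trans (shiftT-sub 0 (ς i)) (sym (subT-shiftT s (ς i)))

subF-shiftS : ∀ ς c φ → subF ς (shiftS c φ) ≡ shiftS c (subF ς φ)
subF-shiftS ς c (t ≐ u)  = refl
subF-shiftS ς c (t <ᵗ u) = refl
subF-shiftS ς c (t ∈ˢ X) = refl
subF-shiftS ς c ⊥'       = refl
subF-shiftS ς c (φ ⇒ ψ)  = cong₂ _⇒_ (subF-shiftS ς c φ) (subF-shiftS ς c ψ)
subF-shiftS ς c (∀ⁿ φ)   = cong ∀ⁿ (subF-shiftS (lift ς) c φ)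
subF-shiftS ς c (∀ˢ φ)   = cong ∀ˢ (subF-shiftS ς (suc c) φ)

subF-substS : ∀ ς k Y φ → subF ς (substS k Y φ) ≡ substS k Y (subF ς φ)
subF-substS ς k Y (t ≐ u)  = refl
subF-substS ς k Y (t <ᵗ u) = refl
subF-substS ς k Y (t ∈ˢ X) = refl
subF-substS ς k Y ⊥'       = refl
subF-substS ς k Y (φ ⇒ ψ)  = cong₂ _⇒_ (subF-substS ς k Y φ) (subF-substS ς k Y ψ)
subF-substS ς k Y (∀ⁿ φ)   = cong ∀ⁿ (subF-substS (lift ς) k Y φ)
subF-substS ς k Y (∀ˢ φ)   = cong ∀ˢ (subF-substS ς (suc k) (suc Y) φ)

Σ⁰₀-sub : ∀ ς → Σ⁰₀ φ → Σ⁰₀ (subF ς φ)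
Σ⁰₀-sub ς (eq t u)   = eq _ _
Σ⁰₀-sub ς (lt t u)   = lt _ _
Σ⁰₀-sub ς (mem t X)  = mem _ X
Σ⁰₀-sub ς bot        = bot
Σ⁰₀-sub ς (imp a b)  = imp (Σ⁰₀-sub ς a) (Σ⁰₀-sub ς b)
Σ⁰₀-sub ς (ball {θ} t a) =
  subst (λ u → Σ⁰₀ (∀ⁿ ((v 0 <ᵗ u) ⇒ subF (lift ς) θ))) (sym (lift-shiftT ς t))
        (ball (subT ς t) (Σ⁰₀-sub (lift ς) a))

Σ⁰₁-sub : ∀ s → Σ⁰₁ φ → Σ⁰₁ (subF s φ)
Σ⁰₁-sub s (σ a) = σ (Σ⁰₀-sub (lift s) a)

Π⁰₁-sub : ∀ s → Π⁰₁ φ → Π⁰₁ (subF s φ)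
Π⁰₁-sub s (π a) = π (Σ⁰₀-sub (lift s) a)

-- Derivations are closed under weakening and substitution of terms

⊢-weaken : Γ ⊆ Δ → Γ ⊢ φ → Δ ⊢ φ
⊢-weaken s (hyp p)      = hyp (s p)
⊢-weaken s (ax a)       = ax a
⊢-weaken s (⇒I d)       = ⇒I (⊢-weaken (∷⁺ʳ _ s) d)
⊢-weaken s (⇒E d e)     = ⇒E (⊢-weaken s d) (⊢-weaken s e)
⊢-weaken s (raa d)      = raa (⊢-weaken (∷⁺ʳ _ s) d)
⊢-weaken s (∀ⁿI d)      = ∀ⁿI (⊢-weaken (map⁺ (shiftN 0) s) d)
⊢-weaken s (∀ⁿE d t)    = ∀ⁿE (⊢-weaken s d) t
⊢-weaken s (∀ˢI d)      = ∀ˢI (⊢-weaken (map⁺ (shiftS 0) s) d)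
⊢-weaken s (∀ˢE d Y)    = ∀ˢE (⊢-weaken s d) Y
⊢-weaken s (≐refl t)    = ≐refl t
⊢-weaken s (≐subst {φ = φ} d e) = ≐subst {φ = φ} (⊢-weaken s d) (⊢-weaken s e)

instantiate : ∀ ς φ → Γ ⊢ subF ς (∀ⁿ φ) → ∀ t → Γ ⊢ subF (t • ς) φ
instantiate ς φ d t = subst (_ ⊢_) (substN-lift t ς φ) (∀ⁿE d t)

-- The axioms hold in every context, so their free variables can be closed by `∀ⁿI` and instantiated
-- again. Two terms are enough for the arithmetical axioms, which mention only `v 0` and `v 1`.
⊢-ax-instance : AxRCA₀ φ → ∀ t u → Γ ⊢ subF (t • u • v) φ
⊢-ax-instance {φ} a t u =
  instantiate (u • v) φ (instantiate v (∀ⁿ φ) (∀ⁿI (∀ⁿI (subst (_ ⊢_) (sym identity) (ax a)))) u) t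
  where
  identity : subF (lift (lift v)) φ ≡ φ
  identity = trans (subF-cong (λ { zero → refl ; (suc zero) → refl ; (suc (suc i)) → refl }) φ)
                   (subF-id φ)

⊢-ax-sub : ∀ s → AxRCA₀ φ → Γ ⊢ subF s φ
⊢-ax-sub s ax1 = ⊢-ax-instance ax1 (s 0) (s 1)
⊢-ax-sub s ax2 = ⊢-ax-instance ax2 (s 0) (s 1)
⊢-ax-sub s ax3 = ⊢-ax-instance ax3 (s 0) (s 1)
⊢-ax-sub s ax4 = ⊢-ax-instance ax4 (s 0) (s 1)
⊢-ax-sub s ax5 = ⊢-ax-instance ax5 (s 0) (s 1)
⊢-ax-sub s ax6 = ⊢-ax-instance ax6 (s 0) (s 1)
⊢-ax-sub s ax7 = ⊢-ax-instance ax7 (s 0) (s 1)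
⊢-ax-sub s ax8 = ⊢-ax-instance ax8 (s 0) (s 1)
⊢-ax-sub s (ind {φ} p) =
  subst₂ (λ α β → _ ⊢ (α ∧ ∀ⁿ (φ′ ⇒ β)) ⇒ ∀ⁿ φ′)
    (sym (subF-substN s zero' φ)) (sym (subF-succInst s φ)) (ax (ind (Σ⁰₁-sub (lift s) p)))
  where φ′ = subF (lift s) φ
⊢-ax-sub s (comp {φ} {ψ} p q) =
  subst (λ α → _ ⊢ ∀ⁿ (subF (lift s) φ ⇔ subF (lift s) ψ) ⇒ ∃ˢ (∀ⁿ ((v 0 ∈ˢ 0) ⇔ α)))
    (sym (subF-shiftS (lift s) 0 φ)) (ax (comp (Σ⁰₁-sub (lift s) p) (Π⁰₁-sub (lift s) q)))

map-comm : ∀ {f g h k : Formula → Formula} → (∀ φ → f (g φ) ≡ h (k φ)) →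
           ∀ Γ → map f (map g Γ) ≡ map h (map k Γ)
map-comm e []      = refl
map-comm e (φ ∷ Γ) = cong₂ _∷_ (e φ) (map-comm e Γ)

⊢-sub : ∀ s → Γ ⊢ φ → map (subF s) Γ ⊢ subF s φ
⊢-sub s (hyp p)   = hyp (∈-map⁺ (subF s) p)
⊢-sub s (ax a)    = ⊢-ax-sub s a
⊢-sub s (⇒I d)    = ⇒I (⊢-sub s d)
⊢-sub s (⇒E d e)  = ⇒E (⊢-sub s d) (⊢-sub s e)
⊢-sub s (raa d)   = raa (⊢-sub s d)
⊢-sub {Γ} s (∀ⁿI d) = ∀ⁿI (subst (_⊢ _) (map-comm (subF-shiftN s) Γ) (⊢-sub (lift s) d))
⊢-sub s (∀ⁿE {φ} d t) = subst (_ ⊢_) (sym (subF-substN s t φ)) (∀ⁿE (⊢-sub s d) (subT s t))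
⊢-sub {Γ} s (∀ˢI d) = ∀ˢI (subst (_⊢ _) (map-comm (subF-shiftS s 0) Γ) (⊢-sub s d))
⊢-sub s (∀ˢE {φ} d Y) = subst (_ ⊢_) (sym (subF-substS s 0 Y φ)) (∀ˢE (⊢-sub s d) Y)
⊢-sub s (≐refl t) = ≐refl (subT s t)
⊢-sub s (≐subst {t} {u} {φ} d e) =
  subst (_ ⊢_) (sym (subF-substN s u φ))
    (≐subst {φ = subF (lift s) φ} (⊢-sub s d) (subst (_ ⊢_) (subF-substN s t φ) (⊢-sub s e)))

-- Free number variables

fvT : Term → ℕ
fvT (v i)    = suc i
fvT zero'    = 0
fvT one'     = 0
fvT (t +ᵗ u) = fvT t ⊔ fvT u
fvT (t *ᵗ u) = fvT t ⊔ fvT u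

fvF : Formula → ℕ
fvF (t ≐ u)  = fvT t ⊔ fvT u
fvF (t <ᵗ u) = fvT t ⊔ fvT u
fvF (t ∈ˢ X) = fvT t
fvF ⊥'       = 0
fvF (φ ⇒ ψ)  = fvF φ ⊔ fvF ψ
fvF (∀ⁿ φ)   = pred (fvF φ)
fvF (∀ˢ φ)   = fvF φ

fvC : List Formula → ℕ
fvC = foldr (λ φ n → fvF φ ⊔ n) 0

AgreeBelow : ℕ → Sub → Sub → Set
AgreeBelow n ς τ = ∀ i → i < n → ς i ≡ τ i

⊔ˡ : ∀ {m n k} → m ⊔ n ≤ k → m ≤ k
⊔ˡ p = ≤-trans (m≤m⊔n _ _) p

⊔ʳ : ∀ {m n k} → m ⊔ n ≤ k → n ≤ k
⊔ʳ {m} p = ≤-trans (m≤n⊔m m _) p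

subT-agree : ∀ {n ς τ} → AgreeBelow n ς τ → ∀ t → fvT t ≤ n → subT ς t ≡ subT τ t
subT-agree e (v i)    p = e i p
subT-agree e zero'    p = refl
subT-agree e one'     p = refl
subT-agree e (t +ᵗ u) p = cong₂ _+ᵗ_ (subT-agree e t (⊔ˡ p)) (subT-agree e u (⊔ʳ {fvT t} p))
subT-agree e (t *ᵗ u) p = cong₂ _*ᵗ_ (subT-agree e t (⊔ˡ p)) (subT-agree e u (⊔ʳ {fvT t} p))

lift-agree : ∀ {n ς τ} → AgreeBelow n ς τ → AgreeBelow (suc n) (lift ς) (lift τ)
lift-agree e zero    p       = refl
lift-agree e (suc i) (s≤s p) = cong (shiftT 0) (e i p)

pred≤ : ∀ {m n} → pred m ≤ n → m ≤ suc n
pred≤ {zero}  p = z≤n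
pred≤ {suc m} p = s≤s p

subF-agree : ∀ {n ς τ} → AgreeBelow n ς τ → ∀ φ → fvF φ ≤ n → subF ς φ ≡ subF τ φ
subF-agree e (t ≐ u)  p = cong₂ _≐_ (subT-agree e t (⊔ˡ p)) (subT-agree e u (⊔ʳ {fvT t} p))
subF-agree e (t <ᵗ u) p = cong₂ _<ᵗ_ (subT-agree e t (⊔ˡ p)) (subT-agree e u (⊔ʳ {fvT t} p))
subF-agree e (t ∈ˢ X) p = cong (_∈ˢ X) (subT-agree e t p)
subF-agree e ⊥'       p = refl
subF-agree e (φ ⇒ ψ)  p = cong₂ _⇒_ (subF-agree e φ (⊔ˡ p)) (subF-agree e ψ (⊔ʳ {fvF φ} p))
subF-agree e (∀ⁿ φ)   p = cong ∀ⁿ (subF-agree (lift-agree e) φ (pred≤ p))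
subF-agree e (∀ˢ φ)   p = cong ∀ˢ (subF-agree e φ p)

-- A proof for every term is in particular a proof for a fresh variable n;
-- renaming n to 0 and shifting everything else turns it into a premise of ∀ⁿI.
generalize : ∀ φ → (∀ t → Γ ⊢ substN 0 t φ) → Γ ⊢ ∀ⁿ φ
generalize {Γ} φ d =
  ∀ⁿI (subst₂ _⊢_ (contexts Γ (m≤m⊔n (fvC Γ) (fvF φ))) goal (⊢-sub ρ (d (v n))))
  where
  n : ℕ
  n = fvC Γ ⊔ fvF φ
  ρ : Sub
  ρ i = if i ≡ᵇ n then v 0 else v (suc i)
  ≡ᵇ-refl : ∀ m → (m ≡ᵇ m) ≡ true
  ≡ᵇ-refl zero    = refl
  ≡ᵇ-refl (suc m) = ≡ᵇ-refl m
  <⇒≢ᵇ : ∀ {i m} → i < m → (i ≡ᵇ m) ≡ false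
  <⇒≢ᵇ {zero}  {suc m} p       = refl
  <⇒≢ᵇ {suc i} {suc m} (s≤s p) = <⇒≢ᵇ p
  ρ-old : AgreeBelow n ρ (v ∘ suc)
  ρ-old i p rewrite <⇒≢ᵇ p = refl
  ρ-new : ρ n ≡ v 0
  ρ-new rewrite ≡ᵇ-refl n = refl
  contexts : ∀ Δ → fvC Δ ≤ n → map (subF ρ) Δ ≡ map (shiftN 0) Δ
  contexts []      p = refl
  contexts (ψ ∷ Δ) p =
    cong₂ _∷_ (trans (subF-agree ρ-old ψ (⊔ˡ p)) (sym (shiftN-sub 0 ψ)))
              (contexts Δ (⊔ʳ {fvF ψ} p))
  pointwise : AgreeBelow (suc n) (subT ρ ∘ substIdx v 0 (v n)) v
  pointwise zero    p       = ρ-new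
  pointwise (suc i) (s≤s p) = ρ-old i p
  goal : subF ρ (substN 0 (v n) φ) ≡ φ
  goal = begin
    subF ρ (substN 0 (v n) φ)                ≡⟨ cong (subF ρ) (substN-sub 0 (v n) φ) ⟩
    subF ρ (subF (substIdx v 0 (v n)) φ)     ≡⟨ subF-∘ _ _ φ ⟩
    subF (subT ρ ∘ substIdx v 0 (v n)) φ     ≡⟨ subF-agree pointwise φ (≤-trans (m≤n⊔m (fvC Γ) (fvF φ)) (n≤1+n n)) ⟩
    subF v φ                                 ≡⟨ subF-id φ ⟩
    φ                                        ∎
    where open ≡-Reasoning

coerce : φ ≡ ψ → Γ ⊢ φ → Γ ⊢ ψ
coerce refl d = d

-- Natural deduction with hypotheses as functions

drop-⊆ : ∀ n (Δ : List Formula) → drop n Δ ⊆ Δ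
drop-⊆ zero    Δ       p = p
drop-⊆ (suc n) (φ ∷ Δ) p = there (drop-⊆ n Δ p)

-- For a literal `n` the smaller context `drop n Δ` is found by computation, so a weakening is given
-- by counting the hypotheses added since.
↑ : ∀ n → drop n Δ ⊢ φ → Δ ⊢ φ
↑ n = ⊢-weaken (drop-⊆ n _)

top : (φ ∷ Γ) ⊢ φ
top = hyp (here refl)

assume : ((φ ∷ Γ) ⊢ φ → (φ ∷ Γ) ⊢ ψ) → Γ ⊢ φ ⇒ ψ
assume f = ⇒I (f top)

by-contra : ((¬' φ ∷ Γ) ⊢ ¬' φ → (¬' φ ∷ Γ) ⊢ ⊥') → Γ ⊢ φ
by-contra f = raa (f top)

⊥E : Γ ⊢ ⊥' → Γ ⊢ φ
⊥E d = raa (↑ 1 d)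

absurd : Γ ⊢ ¬' φ → Γ ⊢ φ → Γ ⊢ ψ
absurd d e = ⊥E (⇒E d e)

by-cases : ∀ φ → ((φ ∷ Γ) ⊢ φ → (φ ∷ Γ) ⊢ ψ) → ((¬' φ ∷ Γ) ⊢ ¬' φ → (¬' φ ∷ Γ) ⊢ ψ) → Γ ⊢ ψ
by-cases φ f g = by-contra λ n →
  ⇒E n (⇒E (↑ 1 (assume g)) (assume λ p → ⇒E (↑ 1 n) (⇒E (↑ 2 (assume f)) p)))

∧I : Γ ⊢ φ → Γ ⊢ ψ → Γ ⊢ φ ∧ ψ
∧I d e = assume λ n → ⇒E (⇒E n (↑ 1 d)) (↑ 1 e)

∧E₁ : Γ ⊢ φ ∧ ψ → Γ ⊢ φ
∧E₁ d = by-contra λ n → ⇒E (↑ 1 d) (assume λ p → absurd (↑ 1 n) p)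

∧E₂ : Γ ⊢ φ ∧ ψ → Γ ⊢ ψ
∧E₂ d = by-contra λ n → ⇒E (↑ 1 d) (assume λ _ → ↑ 1 n)

∨I₁ : Γ ⊢ φ → Γ ⊢ φ ∨ ψ
∨I₁ d = assume λ n → absurd n (↑ 1 d)

∨I₂ : Γ ⊢ ψ → Γ ⊢ φ ∨ ψ
∨I₂ d = assume λ _ → ↑ 1 d

∨E : Γ ⊢ φ ∨ ψ → ((φ ∷ Γ) ⊢ φ → (φ ∷ Γ) ⊢ χ) → ((ψ ∷ Γ) ⊢ ψ → (ψ ∷ Γ) ⊢ χ) → Γ ⊢ χ
∨E d f g = by-cases _ f λ n → ⇒E (↑ 1 (assume g)) (⇒E (↑ 1 d) n)

⇔I : ((φ ∷ Γ) ⊢ φ → (φ ∷ Γ) ⊢ ψ) → ((ψ ∷ Γ) ⊢ ψ → (ψ ∷ Γ) ⊢ φ) → Γ ⊢ φ ⇔ ψ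
⇔I f g = ∧I (assume f) (assume g)

⇔E₁ : Γ ⊢ φ ⇔ ψ → Γ ⊢ φ → Γ ⊢ ψ
⇔E₁ d = ⇒E (∧E₁ d)

⇔E₂ : Γ ⊢ φ ⇔ ψ → Γ ⊢ ψ → Γ ⊢ φ
⇔E₂ d = ⇒E (∧E₂ d)

-- Formulas under an environment of terms

look : List Term → Sub
look []       = v
look (t ∷ ts) = t • look ts

infix 8 _[_]
_[_] : Formula → List Term → Formula
φ [ ts ] = subF (look ts) φ

-- A derivation of φ [ ts ] that remembers φ and ts, which unification cannot
-- recover from the computed formula φ [ ts ].
infix 0 _⊨_at_
record _⊨_at_ (Γ : List Formula) (φ : Formula) (ts : List Term) : Set where
  constructor ⟪_⟫
  field un : Γ ⊢ φ [ ts ]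
open _⊨_at_ public

⇑ : ∀ n → drop n Δ ⊨ φ at ts → Δ ⊨ φ at ts
⇑ n d = ⟪ ↑ n (un d) ⟫

under : ((φ [ ts ] ∷ Γ) ⊨ φ at ts → (φ [ ts ] ∷ Γ) ⊨ ψ at ts) → Γ ⊨ φ ⇒ ψ at ts
under f = ⟪ assume (λ h → un (f ⟪ h ⟫)) ⟫

apply : Γ ⊨ φ ⇒ ψ at ts → Γ ⊢ φ [ ts ] → Γ ⊨ ψ at ts
apply d e = ⟪ ⇒E (un d) e ⟫

fst : Γ ⊨ φ ∧ ψ at ts → Γ ⊨ φ at ts
fst d = ⟪ ∧E₁ (un d) ⟫

snd : Γ ⊨ φ ∧ ψ at ts → Γ ⊨ ψ at ts
snd d = ⟪ ∧E₂ (un d) ⟫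

pair : Γ ⊨ φ at ts → Γ ⊨ ψ at ts → Γ ⊨ φ ∧ ψ at ts
pair d e = ⟪ ∧I (un d) (un e) ⟫

∀I : (∀ x → Γ ⊨ φ at (x ∷ ts)) → Γ ⊨ ∀ⁿ φ at ts
∀I {φ = φ} {ts} f =
  ⟪ generalize _ (λ x → coerce (sym (substN-lift x (look ts) φ)) (un (f x))) ⟫

∀E : Γ ⊨ ∀ⁿ φ at ts → ∀ t → Γ ⊨ φ at (t ∷ ts)
∀E {φ = φ} {ts} d t = ⟪ instantiate (look ts) φ (un d) t ⟫

∃I : ∀ t → Γ ⊨ φ at (t ∷ ts) → Γ ⊨ ∃ⁿ φ at ts
∃I {φ = φ} {ts} t d =
  ⟪ assume (λ n → ⇒E (un (∀E {φ = ¬' φ} {ts} ⟪ n ⟫ t)) (↑ 1 (un d))) ⟫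

-- The witness ranges over all terms instead of being an eigenvariable, so neither `Γ` nor `ψ` is
-- shifted.
∃E : Γ ⊨ ∃ⁿ φ at ts →
     (∀ x → (φ [ x ∷ ts ] ∷ Γ) ⊨ φ at (x ∷ ts) → (φ [ x ∷ ts ] ∷ Γ) ⊢ ψ) → Γ ⊢ ψ
∃E {φ = φ} {ts} d f = by-contra λ n → ⇒E (↑ 1 (un d))
  (un (∀I {φ = ¬' φ} {ts} λ x →
    ⟪ assume (λ h → ⇒E (↑ 1 n) (⇒E (↑ 2 (⇒I (f x ⟪ top ⟫))) h)) ⟫))

-- The bounded existential quantifier is a negated bounded universal one,
-- because ∃ⁿ ((v 0 <ᵗ t) ∧ θ) does not unfold to a Σ⁰₀ formula.
∀< ∃< : Term → Formula → Formula
∀< t θ = ∀ⁿ ((v 0 <ᵗ shiftT 0 t) ⇒ θ)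
∃< t θ = ¬' (∀< t (¬' θ))

-- An arbitrary guard `φ` avoids having to recover a bound from the computed term `shiftT 0 t`.
∃<I : ∀ t → Γ ⊢ φ [ t ∷ ts ] → Γ ⊨ θ at (t ∷ ts) → Γ ⊨ ¬' (∀ⁿ (φ ⇒ ¬' θ)) at ts
∃<I {φ = φ} {ts} {θ} t b d =
  ⟪ assume (λ n → ⇒E (⇒E (un (∀E {φ = φ ⇒ ¬' θ} {ts} ⟪ n ⟫ t)) (↑ 1 b)) (↑ 1 (un d))) ⟫

∃<E : Γ ⊨ ¬' (∀ⁿ (φ ⇒ ¬' θ)) at ts →
      (∀ x → let Δ = θ [ x ∷ ts ] ∷ φ [ x ∷ ts ] ∷ Γ in
         Δ ⊢ φ [ x ∷ ts ] → Δ ⊨ θ at (x ∷ ts) → Δ ⊢ ψ) → Γ ⊢ ψ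
∃<E {φ = φ} {θ} {ts} d f = by-contra λ n → ⇒E (↑ 1 (un d))
  (un (∀I {φ = φ ⇒ ¬' θ} {ts} λ x → ⟪ assume (λ b → assume (λ h →
    ⇒E (↑ 2 n) (⇒E (⇒E (↑ 3 (⇒I (⇒I (f x (↑ 1 top) ⟪ top ⟫)))) (↑ 1 b)) h))) ⟫))

rewrite-at : ∀ φ ts {t u} → Γ ⊢ t ≐ u → Γ ⊢ φ [ t ∷ ts ] → Γ ⊢ φ [ u ∷ ts ]
rewrite-at φ ts {t} {u} e d =
  coerce (substN-lift u (look ts) φ)
    (≐subst {φ = subF (lift (look ts)) φ} e (coerce (sym (substN-lift t (look ts) φ)) d))

-- Recognising Σ⁰₀ formulas

-- A partial inverse of `shiftT 0`, defined exactly on the terms without `v 0`: the side condition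
-- hidden in the shape of `ball`.
unshiftT : Term → Maybe Term
unshiftT (v zero)    = nothing
unshiftT (v (suc i)) = just (v i)
unshiftT zero'       = just zero'
unshiftT one'        = just one'
unshiftT (t +ᵗ u)    = zipWith _+ᵗ_ (unshiftT t) (unshiftT u)
unshiftT (t *ᵗ u)    = zipWith _*ᵗ_ (unshiftT t) (unshiftT u)

unshiftT-sound : ∀ t {u} → unshiftT t ≡ just u → shiftT 0 u ≡ t
unshiftT-sound (v (suc i)) refl = refl
unshiftT-sound zero' refl = refl
unshiftT-sound one'  refl = refl
unshiftT-sound (t +ᵗ u) e with unshiftT t in p | unshiftT u in q
unshiftT-sound (t +ᵗ u) refl | just _ | just _ =
  cong₂ _+ᵗ_ (unshiftT-sound t p) (unshiftT-sound u q)
unshiftT-sound (t *ᵗ u) e with unshiftT t in p | unshiftT u in q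
unshiftT-sound (t *ᵗ u) refl | just _ | just _ =
  cong₂ _*ᵗ_ (unshiftT-sound t p) (unshiftT-sound u q)

bounded? : Formula → Bool
bounded? (t ≐ u)  = true
bounded? (t <ᵗ u) = true
bounded? (t ∈ˢ X) = true
bounded? ⊥'       = true
bounded? (φ ⇒ ψ)  = bounded? φ and bounded? ψ
bounded? (∀ⁿ ((v 0 <ᵗ t) ⇒ θ)) = is-just (unshiftT t) and bounded? θ
bounded? (∀ⁿ _)   = false
bounded? (∀ˢ _)   = false

bounded-sound : ∀ φ → T (bounded? φ) → Σ⁰₀ φ
bounded-sound (t ≐ u)  p = eq t u
bounded-sound (t <ᵗ u) p = lt t u
bounded-sound (t ∈ˢ X) p = mem t X
bounded-sound ⊥'       p = bot
bounded-sound (φ ⇒ ψ)  p =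
  let a , b = Equivalence.to T-∧ p in imp (bounded-sound φ a) (bounded-sound ψ b)
bounded-sound (∀ⁿ ((v 0 <ᵗ t) ⇒ θ)) p with unshiftT t in q
... | just u = subst (λ s → Σ⁰₀ (∀ⁿ ((v 0 <ᵗ s) ⇒ θ))) (unshiftT-sound t q)
                     (ball u (bounded-sound θ p))

-- For a concrete formula the implicit argument evaluates to the unit type and is filled in by eta.
bounded : ∀ φ → {T (bounded? φ)} → Σ⁰₀ φ
bounded φ {b} = bounded-sound φ b

-- Induction

induction₁ : ∀ θ ts → Σ⁰₀ θ → Γ ⊨ ∃ⁿ θ at (zero' ∷ ts) →
  (∀ x → let Δ = (∃ⁿ θ) [ x ∷ ts ] ∷ Γ in
     Δ ⊨ ∃ⁿ θ at (x ∷ ts) → Δ ⊨ ∃ⁿ θ at ((x +ᵗ one') ∷ ts)) →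
  ∀ t → Γ ⊨ ∃ⁿ θ at (t ∷ ts)
induction₁ {Γ} θ ts b base step = ∀E ⟪ ⇒E (ax (ind (Σ⁰₁-sub (lift s) (σ b))))
    (∧I (coerce (sym (substN-lift zero' s φ′)) (un base))
        (generalize _ λ x → subst₂ (λ α β → Γ ⊢ α ⇒ β)
            (sym (substN-lift x s φ′)) (sym (successor x)) (assume λ h → un (step x ⟪ h ⟫)))) ⟫
  where
  s : Sub
  s = look ts
  φ′ : Formula
  φ′ = ∃ⁿ θ
  successor : ∀ x → substN 0 x (succInst (subF (lift s) φ′)) ≡ subF ((x +ᵗ one') • s) φ′
  successor x = begin
    substN 0 x (succInst (subF (lift s) φ′))          ≡⟨ cong (substN 0 x) (subF-succInst s φ′) ⟨
    substN 0 x (subF (lift s) (succInst φ′))          ≡⟨ substN-lift x s (succInst φ′) ⟩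
    subF (x • s) (succInst φ′)                        ≡⟨ cong (subF (x • s)) (succInst-sub φ′) ⟩
    subF (x • s) (subF ((v 0 +ᵗ one') • v ∘ suc) φ′)  ≡⟨ subF-∘ _ _ φ′ ⟩
    subF (subT (x • s) ∘ ((v 0 +ᵗ one') • v ∘ suc)) φ′  ≡⟨ subF-cong (λ { zero → refl ; (suc i) → refl }) φ′ ⟩
    subF ((x +ᵗ one') • s) φ′                         ∎
    where open ≡-Reasoning

shiftN-[] : ∀ θ x ts → shiftN 0 θ [ x ∷ ts ] ≡ θ [ ts ]
shiftN-[] θ x ts = trans (cong (subF _) (shiftN-sub 0 θ)) (subF-∘ _ _ θ)

Σ⁰₀-shift : ∀ c → Σ⁰₀ θ → Σ⁰₀ (shiftN c θ)
Σ⁰₀-shift {θ} c b = subst Σ⁰₀ (sym (shiftN-sub c θ)) (Σ⁰₀-sub _ b)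

∃-vacuousI : ∀ θ ts → Γ ⊨ θ at ts → Γ ⊨ ∃ⁿ (shiftN 0 θ) at ts
∃-vacuousI θ ts d = ∃I zero' ⟪ coerce (sym (shiftN-[] θ zero' ts)) (un d) ⟫

∃-vacuousE : ∀ θ ts → Γ ⊨ ∃ⁿ (shiftN 0 θ) at ts → Γ ⊨ θ at ts
∃-vacuousE θ ts d = ⟪ ∃E {φ = shiftN 0 θ} {ts} d (λ x h → coerce (shiftN-[] θ x ts) (un h)) ⟫

-- The axiom `ind` is for formulas of the literal form Σ⁰₁, so `θ` is prefixed by a vacuous
-- existential quantifier, which is stripped again afterwards.
induction₀ : ∀ θ ts → Σ⁰₀ θ → Γ ⊨ θ at (zero' ∷ ts) →
  (∀ x → let Δ = θ [ x ∷ ts ] ∷ Γ in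
     Δ ⊨ θ at (x ∷ ts) → Δ ⊨ θ at ((x +ᵗ one') ∷ ts)) →
  ∀ t → Γ ⊨ θ at (t ∷ ts)
induction₀ θ ts b base step t = ∃-vacuousE θ (t ∷ ts)
  (induction₁ (shiftN 0 θ) ts (Σ⁰₀-shift 0 b) (∃-vacuousI θ _ base)
    (λ x h → ∃-vacuousI θ _
      ⟪ ⇒E (↑ 1 (⇒I (un (step x ⟪ top ⟫)))) (un (∃-vacuousE θ (x ∷ ts) h)) ⟫) t)

-- Equality and the semiring laws

private variable
  t t′ u u′ w s a b c d i j x y z m n p M n₀ M₀ c₀ : Term
  H : ℕ

≐sym : Γ ⊢ t ≐ u → Γ ⊢ u ≐ t
≐sym {t = t} e = rewrite-at (v 0 ≐ v 1) (t ∷ []) e (≐refl t)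

infixr 4 _⨾_
_⨾_ : Γ ⊢ t ≐ u → Γ ⊢ u ≐ w → Γ ⊢ t ≐ w
_⨾_ {t = t} d e = rewrite-at (v 1 ≐ v 0) (t ∷ []) e d

+cong : Γ ⊢ t ≐ t′ → Γ ⊢ u ≐ u′ → Γ ⊢ t +ᵗ u ≐ t′ +ᵗ u′
+cong {t = t} {t′} {u} d e =
  rewrite-at (v 1 +ᵗ v 2 ≐ v 0 +ᵗ v 2) (t ∷ u ∷ []) d (≐refl _)
  ⨾ rewrite-at (v 1 +ᵗ v 2 ≐ v 1 +ᵗ v 0) (t′ ∷ u ∷ []) e (≐refl _)

*cong : Γ ⊢ t ≐ t′ → Γ ⊢ u ≐ u′ → Γ ⊢ t *ᵗ u ≐ t′ *ᵗ u′
*cong {t = t} {t′} {u} d e =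
  rewrite-at (v 1 *ᵗ v 2 ≐ v 0 *ᵗ v 2) (t ∷ u ∷ []) d (≐refl _)
  ⨾ rewrite-at (v 1 *ᵗ v 2 ≐ v 1 *ᵗ v 0) (t′ ∷ u ∷ []) e (≐refl _)

suc-cong : Γ ⊢ t ≐ u → Γ ⊢ t +ᵗ one' ≐ u +ᵗ one'
suc-cong e = +cong e (≐refl one')

+zero : ∀ t → Γ ⊢ t +ᵗ zero' ≐ t
+zero t = ⊢-ax-instance ax3 t t

+suc : ∀ t u → Γ ⊢ t +ᵗ (u +ᵗ one') ≐ (t +ᵗ u) +ᵗ one'
+suc t u = ⊢-ax-instance ax4 t u

*zero : ∀ t → Γ ⊢ t *ᵗ zero' ≐ zero'
*zero t = ⊢-ax-instance ax5 t t

*suc : ∀ t u → Γ ⊢ t *ᵗ (u +ᵗ one') ≐ (t *ᵗ u) +ᵗ t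
*suc t u = ⊢-ax-instance ax6 t u

+assoc : ∀ t u w → Γ ⊢ (t +ᵗ u) +ᵗ w ≐ t +ᵗ (u +ᵗ w)
+assoc t u w = un (induction₀ θ₀ (t ∷ u ∷ []) (bounded θ₀)
  ⟪ +zero _ ⨾ +cong (≐refl _) (≐sym (+zero _)) ⟫
  (λ x h → ⟪ +suc _ _ ⨾ suc-cong (un h) ⨾ ≐sym (+suc _ _) ⨾ +cong (≐refl _) (≐sym (+suc _ _)) ⟫) w)
  where θ₀ = (v 1 +ᵗ v 2) +ᵗ v 0 ≐ v 1 +ᵗ (v 2 +ᵗ v 0)

zero+ : ∀ t → Γ ⊢ zero' +ᵗ t ≐ t
zero+ = λ t → un (induction₀ θ₀ [] (bounded θ₀) ⟪ +zero _ ⟫ (λ x h → ⟪ +suc _ _ ⨾ suc-cong (un h) ⟫) t)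
  where θ₀ = zero' +ᵗ v 0 ≐ v 0

suc+ : ∀ t u → Γ ⊢ (t +ᵗ one') +ᵗ u ≐ (t +ᵗ u) +ᵗ one'
suc+ t u = un (induction₀ θ₀ (t ∷ []) (bounded θ₀)
  ⟪ +zero _ ⨾ suc-cong (≐sym (+zero _)) ⟫
  (λ x h → ⟪ +suc _ _ ⨾ suc-cong (un h ⨾ ≐sym (+suc _ _)) ⟫) u)
  where θ₀ = (v 1 +ᵗ one') +ᵗ v 0 ≐ (v 1 +ᵗ v 0) +ᵗ one'

+comm : ∀ t u → Γ ⊢ t +ᵗ u ≐ u +ᵗ t
+comm t u = un (induction₀ θ₀ (t ∷ []) (bounded θ₀)
  ⟪ +zero _ ⨾ ≐sym (zero+ _) ⟫
  (λ x h → ⟪ +suc _ _ ⨾ suc-cong (un h) ⨾ ≐sym (suc+ _ _) ⟫) u)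
  where θ₀ = v 1 +ᵗ v 0 ≐ v 0 +ᵗ v 1

zero* : ∀ t → Γ ⊢ zero' *ᵗ t ≐ zero'
zero* = λ t → un (induction₀ θ₀ [] (bounded θ₀) ⟪ *zero _ ⟫ (λ x h → ⟪ *suc _ _ ⨾ +zero _ ⨾ un h ⟫) t)
  where θ₀ = zero' *ᵗ v 0 ≐ zero'

suc* : ∀ t u → Γ ⊢ (t +ᵗ one') *ᵗ u ≐ (t *ᵗ u) +ᵗ u
suc* t u = un (induction₀ θ₀ (t ∷ []) (bounded θ₀)
  ⟪ *zero _ ⨾ ≐sym (*zero _) ⨾ ≐sym (+zero _) ⟫
  (λ x h → ⟪ *suc _ _ ⨾ +cong (un h) (≐refl _) ⨾ +suc _ _
             ⨾ suc-cong (+assoc _ _ _ ⨾ +cong (≐refl _) (+comm _ _) ⨾ ≐sym (+assoc _ _ _)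
                         ⨾ +cong (≐sym (*suc _ _)) (≐refl _))
             ⨾ ≐sym (+suc _ _) ⟫) u)
  where θ₀ = (v 1 +ᵗ one') *ᵗ v 0 ≐ (v 1 *ᵗ v 0) +ᵗ v 0

*comm : ∀ t u → Γ ⊢ t *ᵗ u ≐ u *ᵗ t
*comm t u = un (induction₀ θ₀ (t ∷ []) (bounded θ₀)
  ⟪ *zero _ ⨾ ≐sym (zero* _) ⟫
  (λ x h → ⟪ *suc _ _ ⨾ +cong (un h) (≐refl _) ⨾ ≐sym (suc* _ _) ⟫) u)
  where θ₀ = v 1 *ᵗ v 0 ≐ v 0 *ᵗ v 1

*distribˡ : ∀ t u w → Γ ⊢ t *ᵗ (u +ᵗ w) ≐ t *ᵗ u +ᵗ t *ᵗ w
*distribˡ t u w = un (induction₀ θ₀ (t ∷ u ∷ []) (bounded θ₀)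
  ⟪ *cong (≐refl _) (+zero _) ⨾ ≐sym (+zero _) ⨾ +cong (≐refl _) (≐sym (*zero _)) ⟫
  (λ x h → ⟪ *cong (≐refl _) (+suc _ _) ⨾ *suc _ _ ⨾ +cong (un h) (≐refl _) ⨾ +assoc _ _ _
             ⨾ +cong (≐refl _) (≐sym (*suc _ _)) ⟫) w)
  where θ₀ = v 1 *ᵗ (v 2 +ᵗ v 0) ≐ v 1 *ᵗ v 2 +ᵗ v 1 *ᵗ v 0

*assoc : ∀ t u w → Γ ⊢ (t *ᵗ u) *ᵗ w ≐ t *ᵗ (u *ᵗ w)
*assoc t u w = un (induction₀ θ₀ (t ∷ u ∷ []) (bounded θ₀)
  ⟪ *zero _ ⨾ ≐sym (*zero _) ⨾ *cong (≐refl _) (≐sym (*zero _)) ⟫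
  (λ x h → ⟪ *suc _ _ ⨾ +cong (un h) (≐refl _) ⨾ ≐sym (*distribˡ _ _ _)
             ⨾ *cong (≐refl _) (≐sym (*suc _ _)) ⟫) w)
  where θ₀ = (v 1 *ᵗ v 2) *ᵗ v 0 ≐ v 1 *ᵗ (v 2 *ᵗ v 0)

one* : ∀ t → Γ ⊢ one' *ᵗ t ≐ t
one* t = *cong (≐sym (zero+ one')) (≐refl t) ⨾ suc* zero' t ⨾ +cong (zero* t) (≐refl t) ⨾ zero+ t

-- Modulo provable equality the terms form a semiring, so the library's solver yields derivations.
-- They live in the empty context; `closed` moves them to any other.
term-semiring : CommutativeSemiring 0ℓ 0ℓ
term-semiring = record
  { Carrier = Term
  ; _≈_ = λ t u → [] ⊢ t ≐ u
  ; _+_ = _+ᵗ_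
  ; _*_ = _*ᵗ_
  ; 0# = zero'
  ; 1# = one'
  ; isCommutativeSemiring = isCommutativeSemiringˡ record
    { +-isCommutativeMonoid = record
      { isMonoid = record
        { isSemigroup = record
          { isMagma = record { isEquivalence = isEquivalence ; ∙-cong = +cong }
          ; assoc = +assoc }
        ; identity = zero+ , +zero }
      ; comm = +comm }
    ; *-isCommutativeMonoid = record
      { isMonoid = record
        { isSemigroup = record
          { isMagma = record { isEquivalence = isEquivalence ; ∙-cong = *cong }
          ; assoc = *assoc }
        ; identity = one* , λ t → *comm t one' ⨾ one* t }
      ; comm = *comm }
    ; distribʳ = λ t u w → *comm _ _ ⨾ *distribˡ _ _ _ ⨾ +cong (*comm _ _) (*comm _ _)
    ; zeroˡ = zero* } }
  where
  isEquivalence : IsEquivalence (λ t u → [] ⊢ t ≐ u)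
  isEquivalence = record { refl = λ {t} → ≐refl t ; sym = ≐sym ; trans = _⨾_ }

open NaturalCoefficients term-semiring public using (solve; _:=_; _:+_; _:*_; con)

closed : [] ⊢ φ → Γ ⊢ φ
closed = ⊢-weaken λ ()

-- Order

suc≢zero : Γ ⊢ t +ᵗ one' ≐ zero' → Γ ⊢ ψ
suc≢zero {t = t} e = absurd (⊢-ax-instance ax1 t t) e

suc-injective : Γ ⊢ t +ᵗ one' ≐ u +ᵗ one' → Γ ⊢ t ≐ u
suc-injective {t = t} {u} = ⇒E (⊢-ax-instance ax2 t u)

≮zero : Γ ⊢ t <ᵗ zero' → Γ ⊢ ψ
≮zero {t = t} e = absurd (⊢-ax-instance ax7 t t) e

<suc⇒≤ : Γ ⊢ t <ᵗ u +ᵗ one' → Γ ⊢ t ≤ᵗ u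
<suc⇒≤ {t = t} {u} = ⇔E₁ (⊢-ax-instance ax8 t u)

≤⇒<suc : Γ ⊢ t ≤ᵗ u → Γ ⊢ t <ᵗ u +ᵗ one'
≤⇒<suc {t = t} {u} = ⇔E₂ (⊢-ax-instance ax8 t u)

<cong : Γ ⊢ t ≐ t′ → Γ ⊢ u ≐ u′ → Γ ⊢ t <ᵗ u → Γ ⊢ t′ <ᵗ u′
<cong {t = t} {t′} {u} d e h =
  rewrite-at (v 1 <ᵗ v 0) (t′ ∷ []) e (rewrite-at (v 0 <ᵗ v 1) (u ∷ []) d h)

+cancelʳ : ∀ w → Γ ⊢ t +ᵗ w ≐ u +ᵗ w → Γ ⊢ t ≐ u
+cancelʳ {t = t} {u} w = ⇒E (un (induction₀ θ₀ (t ∷ u ∷ []) (bounded θ₀)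
  (under λ h → ⟪ ≐sym (+zero _) ⨾ un h ⨾ +zero _ ⟫)
  (λ x h → under λ e →
    ⟪ ⇒E (↑ 1 (un h)) (suc-injective (≐sym (+suc _ _) ⨾ un e ⨾ +suc _ _)) ⟫) w))
  where θ₀ = (v 1 +ᵗ v 0 ≐ v 2 +ᵗ v 0) ⇒ (v 1 ≐ v 2)

-- Induction on the larger number. The hypothesis goes inside the quantifier, since an implication
-- into an existential is not literally Σ⁰₁; the price is an arbitrary witness where the hypothesis
-- fails.
<-difference : Γ ⊢ t <ᵗ u → Γ ⊨ ∃ⁿ (v 1 +ᵗ (v 0 +ᵗ one') ≐ v 2) at (t ∷ u ∷ [])
<-difference {t = t} {u} t<u = ⟪ ∃E (induction₁ θ₀ (t ∷ []) (bounded θ₀)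
    (∃I zero' (under λ h → ⟪ ≮zero (un h) ⟫))
    (λ x h → ⟪ ∃E h (λ d p → by-cases (t <ᵗ x)
      (λ q → un (∃I {φ = θ₀} {(x +ᵗ one') ∷ t ∷ []} (d +ᵗ one')
        (under λ _ → ⟪ +suc _ _ ⨾ suc-cong (⇒E (↑ 2 (un p)) (↑ 1 q)) ⟫)))
      -- Here t < x + 1 without t < x forces t = x, so the difference is 0; `≤ᵗ` unfolds to an
      -- implication from `¬' (t <ᵗ x)`.
      (λ q → un (∃I {φ = θ₀} {(x +ᵗ one') ∷ t ∷ []} zero'
        (under λ r → ⟪ +suc _ _ ⨾ suc-cong (+zero _ ⨾ ⇒E (<suc⇒≤ (un r)) (↑ 1 q)) ⟫)))) ⟫)
    u)
  (λ d p → un (∃I {φ = v 1 +ᵗ (v 0 +ᵗ one') ≐ v 2} {t ∷ u ∷ []} d ⟪ ⇒E (un p) (↑ 1 t<u) ⟫)) ⟫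
  where θ₀ = (v 2 <ᵗ v 1) ⇒ (v 2 +ᵗ (v 0 +ᵗ one') ≐ v 1)

<-intro : ∀ d → Γ ⊢ t +ᵗ (d +ᵗ one') ≐ u → Γ ⊢ t <ᵗ u
<-intro {t = t} d e = <cong (≐refl t) e (un (induction₀ θ₀ (t ∷ []) (bounded θ₀)
  ⟪ <cong (≐refl _) (≐sym (+suc _ _)) (≤⇒<suc (∨I₂ (≐sym (+zero _)))) ⟫
  (λ x h → ⟪ <cong (≐refl _) (≐sym (+suc _ _)) (≤⇒<suc (∨I₁ (un h))) ⟫) d))
  where θ₀ = v 1 <ᵗ v 1 +ᵗ (v 0 +ᵗ one')

≤-intro : ∀ d → Γ ⊢ t +ᵗ d ≐ u → Γ ⊢ t ≤ᵗ u
≤-intro d e = <suc⇒≤ (<-intro d (+suc _ _ ⨾ suc-cong e))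

≤-elim : Γ ⊢ t ≤ᵗ u →
  (∀ d → let Δ = (t +ᵗ (d +ᵗ one') ≐ u +ᵗ one') ∷ Γ in Δ ⊢ t +ᵗ d ≐ u → Δ ⊢ ψ) → Γ ⊢ ψ
≤-elim h f = ∃E (<-difference (≤⇒<suc h)) λ d p → f d (suc-injective (≐sym (+suc _ _) ⨾ un p))

<⇒≤ : Γ ⊢ t <ᵗ u → Γ ⊢ t +ᵗ one' ≤ᵗ u
<⇒≤ {t = t} h = ∃E (<-difference h) λ d p →
  ≤-intro d (closed (solve 2 (λ t d → (t :+ con 1) :+ d := t :+ (d :+ con 1)) (≐refl _) t d) ⨾ un p)

≤⇒< : Γ ⊢ t +ᵗ one' ≤ᵗ u → Γ ⊢ t <ᵗ u
≤⇒< {t = t} h = ≤-elim h λ d p →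
  <-intro d (closed (solve 2 (λ t d → t :+ (d :+ con 1) := (t :+ con 1) :+ d) (≐refl _) t d) ⨾ p)

≤refl : Γ ⊢ t ≤ᵗ t
≤refl = ≤-intro zero' (+zero _)

+mono : Γ ⊢ a ≤ᵗ b → Γ ⊢ c ≤ᵗ d → Γ ⊢ a +ᵗ c ≤ᵗ b +ᵗ d
+mono {a = a} {c = c} h k = ≤-elim h λ x p → ≤-elim (↑ 1 k) λ y q →
  ≤-intro (x +ᵗ y)
    (closed (solve 4 (λ a c x y → (a :+ c) :+ (x :+ y) := (a :+ x) :+ (c :+ y)) (≐refl _) a c x y)
     ⨾ +cong (↑ 1 p) q)

-- t ≤ u follows from a ≤ b when u − t = b − a + s.
≤-from : Γ ⊢ a ≤ᵗ b → ∀ s → Γ ⊢ (t +ᵗ b) +ᵗ s ≐ u +ᵗ a → Γ ⊢ t ≤ᵗ u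
≤-from {a = a} {t = t} h s e = ≤-elim h λ d p → ≤-intro (d +ᵗ s)
  (+cancelʳ a (closed (solve 4 (λ t d s a → (t :+ (d :+ s)) :+ a := (t :+ (a :+ d)) :+ s) (≐refl _) t d s a)
               ⨾ +cong (+cong (≐refl _) p) (≐refl _) ⨾ ↑ 1 e))

≤trans : Γ ⊢ t ≤ᵗ u → Γ ⊢ u ≤ᵗ w → Γ ⊢ t ≤ᵗ w
≤trans {t = t} {u} {w} h k = ≤-from (+mono h k) zero'
  (closed (solve 3 (λ t u w → (t :+ (u :+ w)) :+ con 0 := w :+ (t :+ u)) (≐refl _) t u w))

≤-respʳ : Γ ⊢ u ≐ w → Γ ⊢ t ≤ᵗ u → Γ ⊢ t ≤ᵗ w
≤-respʳ {t = t} e = rewrite-at (v 1 ≤ᵗ v 0) (t ∷ []) e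

≤-respˡ : Γ ⊢ t ≐ u → Γ ⊢ t ≤ᵗ w → Γ ⊢ u ≤ᵗ w
≤-respˡ {w = w} e = rewrite-at (v 0 ≤ᵗ v 1) (w ∷ []) e

<-weaken : Γ ⊢ t <ᵗ u → Γ ⊢ t ≤ᵗ u
<-weaken = ∨I₁

<-≤-trans : Γ ⊢ t <ᵗ u → Γ ⊢ u ≤ᵗ w → Γ ⊢ t <ᵗ w
<-≤-trans h k = ≤⇒< (≤trans (<⇒≤ h) k)

≤-<-trans : Γ ⊢ t ≤ᵗ u → Γ ⊢ u <ᵗ w → Γ ⊢ t <ᵗ w
≤-<-trans h k = ≤⇒< (≤trans (+mono h ≤refl) (<⇒≤ k))

<-irrefl : Γ ⊢ t <ᵗ t → Γ ⊢ ψ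
<-irrefl {t = t} h = ∃E (<-difference h) λ d p →
  suc≢zero (+cancelʳ t (+comm _ _ ⨾ un p ⨾ ≐sym (zero+ t)))

≤-or-> : ∀ t u → ((t ≤ᵗ u) ∷ Γ) ⊢ ψ → ((u <ᵗ t) ∷ Γ) ⊢ ψ → Γ ⊢ ψ
≤-or-> t u f g = ∨E (un (induction₀ θ₀ (u ∷ []) (bounded θ₀)
    ⟪ ∨I₁ (≤-intro u (zero+ u)) ⟫
    (λ x h → ⟪ ∨E (un h)
      (λ p → ∨E p (λ q → ∨I₁ (<⇒≤ q)) (λ q → ∨I₂ (≤⇒<suc (∨I₂ (≐sym q)))))
      (λ p → ∨I₂ (≤⇒<suc (∨I₁ p))) ⟫) t))
  (λ _ → f) (λ _ → g)
  where θ₀ = (v 0 ≤ᵗ v 1) ∨ (v 1 <ᵗ v 0)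

-- Ordinary induction on the bound x of a statement about all y < x. `shiftN 1` makes room for x
-- between y and the parameters, and `drop-second` removes it again.
strong-induction : ∀ θ ts → Σ⁰₀ θ →
  (∀ x → let Δ = ∀< (v 0) (shiftN 1 θ) [ x ∷ ts ] ∷ Γ in
     Δ ⊨ ∀< (v 0) (shiftN 1 θ) at (x ∷ ts) → Δ ⊨ θ at (x ∷ ts)) →
  ∀ t → Γ ⊨ θ at (t ∷ ts)
strong-induction {Γ} θ ts b step t =
  ⟪ coerce (drop-second t (t +ᵗ one')) (un (apply (∀E (below (t +ᵗ one')) t) (≤⇒<suc ≤refl))) ⟫
  where
  drop-second : ∀ y x → shiftN 1 θ [ y ∷ x ∷ ts ] ≡ θ [ y ∷ ts ]
  drop-second y x = trans (cong (subF _) (shiftN-sub 1 θ)) (trans (subF-∘ _ _ θ)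
    (subF-cong (λ { zero → refl ; (suc i) → refl }) θ))
  below : ∀ t → Γ ⊨ ∀< (v 0) (shiftN 1 θ) at (t ∷ ts)
  below = induction₀ _ ts (ball (v 0) (Σ⁰₀-shift 1 b))
    (∀I λ y → under λ h → ⟪ ≮zero (un h) ⟫)
    (λ x h → ∀I λ y → under λ y<x+1 → ⟪ ∨E (<suc⇒≤ (un y<x+1))
      (λ p → coerce (trans (drop-second y x) (sym (drop-second y (x +ᵗ one'))))
               (un (apply (∀E (⇑ 2 h) y) p)))
      (λ p → coerce (sym (drop-second y (x +ᵗ one')))
               (rewrite-at θ ts (≐sym p) (↑ 2 (un (step x h))))) ⟫)

-- Divisibility

-- Divides s u says that s + 1 divides u; with a positive divisor the quotient is at most u.
Divides : Term → Term → Formula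
Divides s u = ∃< (u +ᵗ one') ((shiftT 0 s +ᵗ one') *ᵗ v 0 ≐ shiftT 0 u)

∣-intro : ∀ q → Γ ⊢ (s +ᵗ one') *ᵗ q ≐ u → Γ ⊢ Divides s u
∣-intro {s = s} {u} q e = un (∃<I {φ = v 0 <ᵗ v 2 +ᵗ one'} {s ∷ u ∷ []}
    {(v 1 +ᵗ one') *ᵗ v 0 ≐ v 2} q
  (≤⇒<suc (≤-intro (s *ᵗ q)
    (closed (solve 2 (λ s q → q :+ s :* q := (s :+ con 1) :* q) (≐refl _) s q) ⨾ e)))
  ⟪ e ⟫)

∣-elim : Γ ⊢ Divides s u →
  (∀ q → let Δ = ((s +ᵗ one') *ᵗ q ≐ u) ∷ (q <ᵗ u +ᵗ one') ∷ Γ in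
     Δ ⊢ (s +ᵗ one') *ᵗ q ≐ u → Δ ⊢ ψ) → Γ ⊢ ψ
∣-elim {s = s} {u} h f = ∃<E {φ = v 0 <ᵗ v 2 +ᵗ one'} {(v 1 +ᵗ one') *ᵗ v 0 ≐ v 2} {s ∷ u ∷ []}
  ⟪ h ⟫ λ q _ p → f q (un p)

∣-resp : Γ ⊢ s ≐ t → Γ ⊢ u ≐ w → Γ ⊢ Divides s u → Γ ⊢ Divides t w
∣-resp {t = t} {u} d e h =
  rewrite-at (Divides (v 1) (v 0)) (t ∷ []) e (rewrite-at (Divides (v 0) (v 1)) (u ∷ []) d h)

∣-*ʳ : ∀ w → Γ ⊢ Divides s u → Γ ⊢ Divides s (u *ᵗ w)
∣-*ʳ w h = ∣-elim h λ q e → ∣-intro (q *ᵗ w) (≐sym (*assoc _ _ _) ⨾ *cong e (≐refl w))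

∣-*ˡ : ∀ t s → Γ ⊢ Divides s (t *ᵗ (s +ᵗ one'))
∣-*ˡ t s = ∣-intro t (*comm _ _)

positive-* : ∀ s → Γ ⊢ zero' <ᵗ t → Γ ⊢ zero' <ᵗ t *ᵗ (s +ᵗ one')
positive-* {t = t} s h = <-≤-trans h (≤-intro (t *ᵗ s)
  (closed (solve 2 (λ t s → t :+ t :* s := t :* (s :+ con 1)) (≐refl _) t s)))

positive-elim : Γ ⊢ zero' <ᵗ t →
  (∀ r → let Δ = (zero' +ᵗ (r +ᵗ one') ≐ t) ∷ Γ in Δ ⊢ r +ᵗ one' ≐ t → Δ ⊢ ψ) → Γ ⊢ ψ
positive-elim h f = ∃E (<-difference h) λ r p → f r (≐sym (zero+ _) ⨾ un p)

-- The witness is the product of j A + B + 1 over j < m, remembered only as a positive common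
-- multiple. A = 1, B = 0 gives a multiple of 1, ..., m; A = B = D gives a code of the set of all
-- colours, with moduli (j + 1) D + 1.
common-multiple : ∀ A B m →
  Γ ⊨ ∃ⁿ ((zero' <ᵗ v 0) ∧ ∀< (v 1) (Divides (v 0 *ᵗ v 3 +ᵗ v 4) (v 1))) at (m ∷ A ∷ B ∷ [])
common-multiple A B = induction₁ _ (A ∷ B ∷ [])
  (bounded ((zero' <ᵗ v 0) ∧ ∀< (v 1) (Divides (v 0 *ᵗ v 3 +ᵗ v 4) (v 1))))
  (∃I one' (pair ⟪ <-intro zero' (zero+ _ ⨾ zero+ _) ⟫ (∀I λ j → under λ h → ⟪ ≮zero (un h) ⟫)))
  λ m h → ⟪ ∃E h (λ p hp → un (∃I
    {φ = (zero' <ᵗ v 0) ∧ ∀< (v 1) (Divides (v 0 *ᵗ v 3 +ᵗ v 4) (v 1))} {(m +ᵗ one') ∷ A ∷ B ∷ []}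
    (p *ᵗ ((m *ᵗ A +ᵗ B) +ᵗ one'))
    (pair ⟪ positive-* _ (un (fst hp)) ⟫
      (∀I λ j → under λ j<m+1 → ⟪ ∨E (<suc⇒≤ (un j<m+1))
        (λ j<m → ∣-*ʳ _ (un (apply (∀E (⇑ 2 (snd hp)) j) j<m)))
        (λ j≐m → ∣-resp (+cong (*cong (≐sym j≐m) (≐refl A)) (≐refl B)) (≐refl _) (∣-*ˡ p _)) ⟫)))) ⟫

-- Without subtraction, the congruence of c to 0 modulo s + 1 is expressed by the equation assumed
-- here. If x ≤ y the quotient is y - x; otherwise the left side is too large.
∣-cancel : ∀ x y → Γ ⊢ c +ᵗ (s +ᵗ one') *ᵗ x ≐ (s +ᵗ one') *ᵗ y → Γ ⊢ Divides s c
∣-cancel {c = c} {s} x y e = ≤-or-> x y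
  (≤-elim top λ r p → ∣-intro r (+cancelʳ ((s +ᵗ one') *ᵗ x)
    (closed (solve 3 (λ d x r → d :* r :+ d :* x := d :* (x :+ r)) (≐refl _) (s +ᵗ one') x r)
     ⨾ *cong (≐refl _) p ⨾ ≐sym (↑ 2 e))))
  (∃E (<-difference top) λ r p → suc≢zero (+cancelʳ ((s +ᵗ one') *ᵗ y)
    (closed (solve 4 (λ c s r y → ((c :+ ((s :+ con 1) :* r :+ s)) :+ con 1) :+ (s :+ con 1) :* y
                          := c :+ (s :+ con 1) :* (y :+ (r :+ con 1))) (≐refl _) c s r y)
     ⨾ +cong (≐refl c) (*cong (≐refl _) (un p)) ⨾ ↑ 2 e ⨾ ≐sym (zero+ _))))

-- Modulo D = I M + 1 one has (I M)² = 1, so M² is invertible.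
∣-unit : ∀ I M x y → Γ ⊢ c *ᵗ (M *ᵗ M) +ᵗ (I *ᵗ M +ᵗ one') *ᵗ x ≐ (I *ᵗ M +ᵗ one') *ᵗ y →
         Γ ⊢ Divides (I *ᵗ M) c
∣-unit {c = c} I M x y e = ∣-cancel (c *ᵗ (I *ᵗ M) +ᵗ x *ᵗ (I *ᵗ I)) (y *ᵗ (I *ᵗ I) +ᵗ c)
  (closed (solve 4 (λ c I M x →
      c :+ (I :* M :+ con 1) :* (c :* (I :* M) :+ x :* (I :* I))
        := (c :* (M :* M) :+ (I :* M :+ con 1) :* x) :* (I :* I) :+ (I :* M :+ con 1) :* c)
      (≐refl _) c I M x)
   ⨾ +cong (*cong e (≐refl _)) (≐refl _)
   ⨾ closed (solve 4 (λ c I D y → (D :* y) :* (I :* I) :+ D :* c := D :* (y :* (I :* I) :+ c))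
       (≐refl _) c I (I *ᵗ M +ᵗ one') y))

MultipleOfAll : Formula
MultipleOfAll = ∀< (v 1) (Divides (v 0) (v 1))

multiple-of-all : ∀ n → Γ ⊨ ∃ⁿ ((zero' <ᵗ v 0) ∧ MultipleOfAll) at (n ∷ [])
multiple-of-all n = ⟪ ∃E (common-multiple one' zero' n) (λ M hM →
  un (∃I {φ = (zero' <ᵗ v 0) ∧ MultipleOfAll} {n ∷ []} M (pair ⟪ un (fst hM) ⟫
    (∀I λ j → under λ j<n →
      ⟪ ∣-resp (closed (solve 1 (λ j → j :* con 1 :+ con 0 := j) (≐refl _) j)) (≐refl M)
          (un (apply (∀E (⇑ 1 (snd hM)) j) (un j<n))) ⟫)))) ⟫

-- The two moduli differ by (e + 1) M, where e + 1 is the distance between `i` and `j`. It divides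
-- M, say (e + 1) f = M, so multiplying by f turns the hypothesis into the vanishing of c M² modulo
-- the modulus of `i`, and `∣-unit` applies. No factorisation into primes is involved.
coprime : Γ ⊨ MultipleOfAll at (M ∷ n ∷ []) → Γ ⊢ i <ᵗ n → Γ ⊢ j <ᵗ n → Γ ⊢ ¬' (i ≐ j) →
  Γ ⊢ Divides ((i +ᵗ one') *ᵗ M) (c *ᵗ ((j +ᵗ one') *ᵗ M +ᵗ one')) →
  Γ ⊢ Divides ((i +ᵗ one') *ᵗ M) c
coprime {M = M} {n} {i} {j} {c} hM i<n j<n i≢j h = ∣-elim h λ q hq →
  ≤-or-> i j
    (∨E top
      (λ i<j → ∃E (<-difference i<j) λ e j≐ →
        ∣-elim (un (apply (∀E (⇑ 5 hM) e) (<-≤-trans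
            (<-intro i (closed (solve 2 (λ i e → e :+ (i :+ con 1) := i :+ (e :+ con 1)) (≐refl _) i e) ⨾ un j≐))
            (<-weaken (↑ 5 j<n))))) λ f hf →
        ∣-unit (i +ᵗ one') M (c *ᵗ f) (q *ᵗ f)
          (+cong (*cong (≐refl c) (*cong (≐sym hf) (≐refl M))) (≐refl _)
           ⨾ closed (solve 5 (λ c e f M i →
               c :* (((e :+ con 1) :* f) :* M) :+ ((i :+ con 1) :* M :+ con 1) :* (c :* f)
                 := (c :* (((i :+ (e :+ con 1)) :+ con 1) :* M :+ con 1)) :* f) (≐refl _) c e f M i)
           ⨾ *cong (*cong (≐refl c) (suc-cong (*cong (suc-cong (↑ 2 (un j≐))) (≐refl M)))) (≐refl f)
           ⨾ *cong (≐sym (↑ 5 hq)) (≐refl f)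
           ⨾ *assoc _ _ _))
      (λ i≐j → absurd (↑ 4 i≢j) i≐j))
    (∃E (<-difference top) λ e i≐ →
      ∣-elim (un (apply (∀E (⇑ 4 hM) e) (<-≤-trans
          (<-intro j (closed (solve 2 (λ i e → e :+ (i :+ con 1) := i :+ (e :+ con 1)) (≐refl _) j e) ⨾ un i≐))
          (<-weaken (↑ 4 i<n))))) λ f hf →
      ∣-unit (i +ᵗ one') M (q *ᵗ f) (c *ᵗ f)
        (+cong (*cong (≐refl c) (*cong (≐sym hf) (≐refl M))) (≐sym (*assoc _ _ _) ⨾ *cong (↑ 4 hq) (≐refl f))
         ⨾ closed (solve 5 (λ c e f M j →
             c :* (((e :+ con 1) :* f) :* M) :+ (c :* ((j :+ con 1) :* M :+ con 1)) :* f
               := (((j :+ (e :+ con 1)) :+ con 1) :* M :+ con 1) :* (c :* f)) (≐refl _) c e f M j)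
         ⨾ *cong (suc-cong (*cong (suc-cong (↑ 2 (un i≐))) (≐refl M))) (≐refl _)))

-- Finite sets

-- Gödel's coding: z belongs to the set coded by p relative to M when (z + 1) M + 1 divides p.
-- These moduli are pairwise coprime for z < n if M is a multiple of 1, …, n.
Member : Term → Term → Term → Formula
Member z M p = Divides ((z +ᵗ one') *ᵗ M) p

Adjoined : Term → Term → Term → Term → Term → Formula
Adjoined z n₀ M₀ c₀ y = ((z <ᵗ n₀) ∧ Member z M₀ c₀) ∨ (z ≐ y)

member-resp : Γ ⊢ t ≐ z → Γ ⊢ Member t M p → Γ ⊢ Member z M p
member-resp e = ∣-resp (*cong (suc-cong e) (≐refl _)) (≐refl _)

adjoined-resp : Γ ⊢ t ≐ z → Γ ⊢ Adjoined t n₀ M₀ c₀ y → Γ ⊢ Adjoined z n₀ M₀ c₀ y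
adjoined-resp {n₀ = n₀} {M₀} {c₀} {y} =
  rewrite-at (Adjoined (v 0) (v 1) (v 2) (v 3) (v 4)) (n₀ ∷ M₀ ∷ c₀ ∷ y ∷ [])

∤one : Γ ⊢ zero' <ᵗ s → Γ ⊢ Divides s one' → Γ ⊢ ψ
∤one {s = s} h k = positive-elim h λ r hr → ∣-elim (↑ 1 k) λ q hq → ≤-or-> q zero'
  (∨E top ≮zero λ q≐0 → suc≢zero (zero+ one' ⨾ ≐sym (↑ 2 hq) ⨾ *cong (≐refl _) q≐0 ⨾ *zero _))
  (positive-elim top λ x hx → suc≢zero (suc-injective
    (closed (solve 2 (λ r x → ((r :+ ((r :+ con 1) :+ con 1) :* x) :+ con 1) :+ con 1
                            := ((r :+ con 1) :+ con 1) :* (x :+ con 1)) (≐refl _) r x)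
     ⨾ *cong (suc-cong (↑ 4 hr)) hx ⨾ ↑ 2 hq ⨾ ≐sym (zero+ one'))))

-- In the environment p, m, n, M, n₀, M₀, c₀, y: the invariant once the numbers below m have been
-- processed. It also covers m ≤ z < n, so that no later number is present before its turn.
CodesBelow : Formula
CodesBelow = ∀< (v 2) (Member (v 0) (v 4) (v 1) ⇔ ((v 0 <ᵗ v 2) ∧ Adjoined (v 0) (v 5) (v 6) (v 7) (v 8)))

module _ {Γ : List Formula} {m n M n₀ M₀ c₀ y p : Term} where

  private
    ps : List Term
    ps = n ∷ M ∷ n₀ ∷ M₀ ∷ c₀ ∷ y ∷ []

  codes-multiply : Γ ⊨ MultipleOfAll at (M ∷ n ∷ []) → Γ ⊨ CodesBelow at (p ∷ m ∷ ps) →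
    Γ ⊢ m <ᵗ n → Γ ⊢ Adjoined m n₀ M₀ c₀ y →
    Γ ⊨ CodesBelow at ((p *ᵗ ((m +ᵗ one') *ᵗ M +ᵗ one')) ∷ (m +ᵗ one') ∷ ps)
  codes-multiply hM hp m<n hm = ∀I λ z → under λ z<n → ⟪ ⇔I
    (λ h → by-cases (z ≐ m)
      (λ z≐m → ∧I (≤⇒<suc (∨I₂ z≐m)) (adjoined-resp (≐sym z≐m) (↑ 3 hm)))
      (λ z≢m → let k = ⇔E₁ (un (apply (∀E (⇑ 3 hp) z) (↑ 2 (un z<n))))
                          (coprime (⇑ 3 hM) (↑ 2 (un z<n)) (↑ 3 m<n) z≢m (↑ 1 h))
               in ∧I (≤⇒<suc (∨I₁ (∧E₁ k))) (∧E₂ k)))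
    (λ h → ∨E (<suc⇒≤ (∧E₁ h))
      (λ z<m → ∣-*ʳ _ (⇔E₂ (un (apply (∀E (⇑ 3 hp) z) (↑ 2 (un z<n)))) (∧I z<m (∧E₂ (↑ 1 h)))))
      (λ z≐m → member-resp (≐sym z≐m) (∣-*ˡ p _))) ⟫

  codes-skip : Γ ⊨ CodesBelow at (p ∷ m ∷ ps) → Γ ⊢ ¬' ((m <ᵗ n) ∧ Adjoined m n₀ M₀ c₀ y) →
    Γ ⊨ CodesBelow at (p ∷ (m +ᵗ one') ∷ ps)
  codes-skip hp hm = ∀I λ z → under λ z<n → ⟪ ⇔I
    (λ h → let k = ⇔E₁ (un (apply (∀E (⇑ 2 hp) z) (↑ 1 (un z<n)))) h
           in ∧I (≤⇒<suc (∨I₁ (∧E₁ k))) (∧E₂ k))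
    (λ h → ∨E (<suc⇒≤ (∧E₁ h))
      (λ z<m → ⇔E₂ (un (apply (∀E (⇑ 3 hp) z) (↑ 2 (un z<n)))) (∧I z<m (∧E₂ (↑ 1 h))))
      (λ z≐m → absurd (↑ 3 hm) (∧I (<cong z≐m (≐refl n) (↑ 2 (un z<n)))
                                   (adjoined-resp z≐m (∧E₂ (↑ 1 h)))))) ⟫

-- In the environment p, M, n, n₀, M₀, c₀, y: the triple p, M, n is the new code with its range.
Adjunction : Formula
Adjunction = ∀< (v 2) (Member (v 0) (v 2) (v 1) ⇔ Adjoined (v 0) (v 4) (v 5) (v 6) (v 7))

-- A larger range requires an M divisible by more numbers, and this changes every modulus. One extra
-- factor is therefore not enough: the set is recoded from scratch by running through all m < n.
adjoin : ∀ n n₀ M₀ c₀ y → Γ ⊨ ∃ⁿ (∃ⁿ Adjunction) at (n ∷ n₀ ∷ M₀ ∷ c₀ ∷ y ∷ [])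
adjoin n n₀ M₀ c₀ y = ⟪ ∃E (multiple-of-all n) (λ M hM →
    let ps = n ∷ M ∷ n₀ ∷ M₀ ∷ c₀ ∷ y ∷ []
        codes = induction₁ CodesBelow ps (bounded CodesBelow)
          -- The empty product: 1 codes the empty set, because M > 0 makes every modulus exceed 1.
          (∃I one' (∀I λ z → under λ _ → ⟪ ⇔I
            (∤one (<-≤-trans (↑ 2 (un (fst hM))) (≤-intro (z *ᵗ M)
              (closed (solve 2 (λ M z → M :+ z :* M := (z :+ con 1) :* M) (≐refl _) M z)))))
            (λ h → ≮zero (∧E₁ h)) ⟫))
          (λ m h → ⟪ ∃E h (λ p hp → by-cases ((m <ᵗ n) ∧ Adjoined m n₀ M₀ c₀ y)
            (λ k → un (∃I {φ = CodesBelow} {(m +ᵗ one') ∷ ps} (p *ᵗ ((m +ᵗ one') *ᵗ M +ᵗ one'))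
              (codes-multiply (⇑ 3 (snd hM)) (⇑ 1 hp) (∧E₁ k) (∧E₂ k))))
            (λ k → un (∃I {φ = CodesBelow} {(m +ᵗ one') ∷ ps} p (codes-skip (⇑ 1 hp) k)))) ⟫)
          n
    in ∃E codes λ p hp →
      un (∃I {φ = ∃ⁿ Adjunction} {n ∷ n₀ ∷ M₀ ∷ c₀ ∷ y ∷ []} M
         (∃I {φ = Adjunction} {M ∷ n ∷ n₀ ∷ M₀ ∷ c₀ ∷ y ∷ []} p
           (∀I λ z → under λ z<n → ⟪ ⇔I
             (λ h → ∧E₂ (⇔E₁ (un (apply (∀E (⇑ 2 hp) z) (↑ 1 (un z<n)))) h))
             (λ h → ⇔E₂ (un (apply (∀E (⇑ 2 hp) z) (↑ 1 (un z<n)))) (∧I (↑ 1 (un z<n)) h)) ⟫)))) ⟫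

-- Pairing

≤-square : ∀ t → Γ ⊢ t ≤ᵗ t *ᵗ t
≤-square t = ≤-or-> t zero'
  (∨E top ≮zero λ t≐0 → ≤-intro zero' (+zero _ ⨾ t≐0 ⨾ ≐sym (*zero _) ⨾ *cong (≐refl t) (≐sym t≐0)))
  (positive-elim top λ r hr → ≤-intro (t *ᵗ r)
    (closed (solve 2 (λ t r → t :+ t :* r := t :* (r :+ con 1)) (≐refl _) t r) ⨾ *cong (≐refl t) hr))

≤-pairˡ : ∀ t u → Γ ⊢ t ≤ᵗ ⟨ t , u ⟩
≤-pairˡ t u = ≤-intro ((t +ᵗ u) *ᵗ (t +ᵗ u)) (+comm _ _)

≤-pairʳ : ∀ t u → Γ ⊢ u ≤ᵗ ⟨ t , u ⟩
≤-pairʳ t u = ≤trans (≤trans (≤-intro t (+comm _ _)) (≤-square (t +ᵗ u))) (≤-intro t (≐refl _))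

-- With s = t + u the code lies between s² and s² + s, hence below (s + 1)². The long polynomial is
-- the excess of the larger code, less 1.
pair-sum-≮ : ∀ t u t′ u′ → Γ ⊢ ⟨ t , u ⟩ ≐ ⟨ t′ , u′ ⟩ → Γ ⊢ t +ᵗ u <ᵗ t′ +ᵗ u′ → Γ ⊢ ψ
pair-sum-≮ t u t′ u′ e h = ∃E (<-difference h) λ d p → suc≢zero (+cancelʳ ⟨ t , u ⟩
  (closed (solve 4 (λ t u t′ d →
      ((((con 2 :* (t :+ u)) :* d :+ (t :+ con 2 :* u)) :+ ((d :* d :+ con 2 :* d) :+ t′)) :+ con 1)
        :+ ((t :+ u) :* (t :+ u) :+ t)
      := ((t :+ u) :+ (d :+ con 1)) :* ((t :+ u) :+ (d :+ con 1)) :+ t′) (≐refl _) t u t′ d)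
   ⨾ +cong (*cong (un p) (un p)) (≐refl t′) ⨾ ≐sym (↑ 1 e) ⨾ ≐sym (zero+ _)))

pair-sum : ∀ t u t′ u′ → Γ ⊢ ⟨ t , u ⟩ ≐ ⟨ t′ , u′ ⟩ → Γ ⊢ t +ᵗ u ≐ t′ +ᵗ u′
pair-sum t u t′ u′ e = ≤-or-> (t +ᵗ u) (t′ +ᵗ u′)
  (∨E top (pair-sum-≮ t u t′ u′ (↑ 2 e)) (λ h → h))
  (pair-sum-≮ t′ u′ t u (≐sym (↑ 1 e)) top)

pair-injectiveˡ : ∀ t u t′ u′ → Γ ⊢ ⟨ t , u ⟩ ≐ ⟨ t′ , u′ ⟩ → Γ ⊢ t ≐ t′
pair-injectiveˡ t u t′ u′ e = let s = pair-sum t u t′ u′ e in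
  +cancelʳ ((t +ᵗ u) *ᵗ (t +ᵗ u)) (+comm _ _ ⨾ e ⨾ +comm _ _ ⨾ +cong (≐refl t′) (≐sym (*cong s s)))

pair-injectiveʳ : ∀ t u t′ u′ → Γ ⊢ ⟨ t , u ⟩ ≐ ⟨ t′ , u′ ⟩ → Γ ⊢ u ≐ u′
pair-injectiveʳ t u t′ u′ e =
  +cancelʳ t (+comm _ _ ⨾ pair-sum t u t′ u′ e ⨾ +comm _ _
              ⨾ +cong (≐refl u′) (≐sym (pair-injectiveˡ t u t′ u′ e)))

pair-cong : Γ ⊢ t ≐ s → Γ ⊢ u ≐ w → Γ ⊢ ⟨ t , u ⟩ ≐ ⟨ s , w ⟩
pair-cong d e = +cong (*cong (+cong d e) (+cong d e)) d

-- Coded increasing sequences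

Entry : Term → Term → Term → Term → Term → Formula
Entry i x c M n = (⟨ i , x ⟩ <ᵗ n) ∧ Member ⟨ i , x ⟩ M c

entry-< : Γ ⊢ Entry i x c M n → Γ ⊢ i <ᵗ n
entry-< {i = i} {x} h = ≤-<-trans (≤-pairˡ i x) (∧E₁ h)

entry-<′ : Γ ⊢ Entry i x c M n → Γ ⊢ x <ᵗ n
entry-<′ {i = i} {x} h = ≤-<-trans (≤-pairʳ i x) (∧E₁ h)

-- In the environment c, M, n, b, ℓ the number c codes, relative to M and n,
-- an increasing sequence of length ℓ of elements of H; b only bounds c, M and n.
Total Increasing : Formula
Ranges Chain : ℕ → Formula
Total = ∀< (v 4) (∃< (v 3) (Entry (v 1) (v 0) (v 2) (v 3) (v 4)))
Ranges H = ∀< (v 2) (∀< (v 3)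
  (Entry (v 1) (v 0) (v 2) (v 3) (v 4) ⇒ ((v 1 <ᵗ v 6) ∧ (v 0 ∈ˢ H))))
Increasing = ∀< (v 2) (∀< (v 3) (∀< (v 4) (∀< (v 5)
  (Entry (v 3) (v 2) (v 4) (v 5) (v 6) ⇒ Entry (v 1) (v 0) (v 4) (v 5) (v 6) ⇒
   (v 3 <ᵗ v 1) ⇒ (v 2 <ᵗ v 0)))))
Chain H = Total ∧ Ranges H ∧ Increasing

-- The common bound b turns the quantifiers over n, M and c into bounded ones and is itself the one
-- unbounded witness that `induction₁` admits.
HasChain : ℕ → Formula
HasChain H = ∃< (v 0) (∃< (v 1) (∃< (v 2) (Chain H)))

chain-total : ∀ c M n b ℓ i → Γ ⊨ Chain H at (c ∷ M ∷ n ∷ b ∷ ℓ ∷ []) → Γ ⊢ i <ᵗ ℓ →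
  (∀ x → let Δ = Entry i x c M n ∷ (x <ᵗ n) ∷ Γ in Δ ⊢ Entry i x c M n → Δ ⊢ ψ) → Γ ⊢ ψ
chain-total c M n b ℓ i h i<ℓ f = ∃<E (apply (∀E (fst h) i) i<ℓ) λ x _ e → f x (un e)

chain-ranges : ∀ c M n b ℓ i x → Γ ⊨ Chain H at (c ∷ M ∷ n ∷ b ∷ ℓ ∷ []) → Γ ⊢ Entry i x c M n →
  Γ ⊢ (i <ᵗ ℓ) ∧ (x ∈ˢ H)
chain-ranges c M n b ℓ i x h e =
  un (apply (apply (∀E (apply (∀E (fst (snd h)) i) (entry-< e)) x) (entry-<′ e)) e)

chain-increasing : ∀ c M n b ℓ i x j y → Γ ⊨ Chain H at (c ∷ M ∷ n ∷ b ∷ ℓ ∷ []) →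
  Γ ⊢ Entry i x c M n → Γ ⊢ Entry j y c M n → Γ ⊢ i <ᵗ j → Γ ⊢ x <ᵗ y
chain-increasing c M n b ℓ i x j y h e k i<j =
  un (apply (apply (apply (apply (∀E (apply (∀E (apply (∀E (apply (∀E (snd (snd h)) i) (entry-< e)) x)
    (entry-<′ e)) j) (entry-< k)) y) (entry-<′ k)) e) k) i<j)

Unbounded : ℕ → Formula
Unbounded H = ∀ⁿ (∃ⁿ ((v 1 <ᵗ v 0) ∧ (v 0 ∈ˢ H)))

module Extension (H : ℕ) (c M n b ℓ y c′ M′ b′ : Term) where

  private
    ℓy n′ : Term
    ℓy = ⟨ ℓ , y ⟩
    n′ = (n +ᵗ ℓy) +ᵗ one'
    old new adjunction : List Term
    old = c ∷ M ∷ n ∷ b ∷ ℓ ∷ []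
    new = c′ ∷ M′ ∷ n′ ∷ b′ ∷ (ℓ +ᵗ one') ∷ []
    adjunction = c′ ∷ M′ ∷ n′ ∷ n ∷ M ∷ c ∷ ℓy ∷ []

  n<n′ : Γ ⊢ n <ᵗ n′
  n<n′ = ≤⇒<suc (≤-intro ℓy (≐refl _))

  ℓy<n′ : Γ ⊢ ℓy <ᵗ n′
  ℓy<n′ = ≤⇒<suc (≤-intro n (+comm _ _))

  entry-old : Γ ⊨ Adjunction at adjunction → Γ ⊢ Entry i x c M n → Γ ⊢ Entry i x c′ M′ n′
  entry-old a e = let z<n′ = <-≤-trans (∧E₁ e) (<-weaken n<n′) in
    ∧I z<n′ (⇔E₂ (un (apply (∀E a _) z<n′)) (∨I₁ e))

  entry-new : Γ ⊨ Adjunction at adjunction → Γ ⊢ i ≐ ℓ → Γ ⊢ x ≐ y → Γ ⊢ Entry i x c′ M′ n′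
  entry-new a d e = let z<n′ = <cong (≐sym (pair-cong d e)) (≐refl n′) ℓy<n′ in
    ∧I z<n′ (⇔E₂ (un (apply (∀E a _) z<n′)) (∨I₂ (pair-cong d e)))

  entry-cases : Γ ⊨ Adjunction at adjunction → Γ ⊢ Entry i x c′ M′ n′ →
    (Entry i x c M n ∷ Γ ⊢ Entry i x c M n → Entry i x c M n ∷ Γ ⊢ ψ) →
    (let Δ = (⟨ i , x ⟩ ≐ ℓy) ∷ Γ in Δ ⊢ i ≐ ℓ → Δ ⊢ x ≐ y → Δ ⊢ ψ) → Γ ⊢ ψ
  entry-cases a e f g = ∨E (⇔E₁ (un (apply (∀E a _) (∧E₁ e))) (∧E₂ e)) f
    λ h → g (pair-injectiveˡ _ _ ℓ y h) (pair-injectiveʳ _ _ ℓ y h)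

  extend-total : Γ ⊨ Chain H at old → Γ ⊨ Adjunction at adjunction → Γ ⊨ Total at new
  extend-total h a = ∀I λ i → under λ i<ℓ+1 → ⟪ ∨E (<suc⇒≤ (un i<ℓ+1))
    (λ i<ℓ → chain-total c M n b ℓ i (⇑ 2 h) i<ℓ λ x e →
      let e′ = entry-old (⇑ 4 a) e in
      un (∃<I {φ = v 0 <ᵗ v 4} {i ∷ new} {Entry (v 1) (v 0) (v 2) (v 3) (v 4)} x (entry-<′ e′) ⟪ e′ ⟫))
    (λ i≐ℓ → let e′ = entry-new (⇑ 2 a) i≐ℓ (≐refl y) in
      un (∃<I {φ = v 0 <ᵗ v 4} {i ∷ new} {Entry (v 1) (v 0) (v 2) (v 3) (v 4)} y (entry-<′ e′) ⟪ e′ ⟫)) ⟫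

  extend-ranges : Γ ⊨ Chain H at old → Γ ⊨ Adjunction at adjunction → Γ ⊢ y ∈ˢ H →
    Γ ⊨ Ranges H at new
  extend-ranges h a y∈H = ∀I λ i → under λ _ → ∀I λ x → under λ _ → under λ e →
    ⟪ entry-cases (⇑ 3 a) (un e)
      (λ e₀ → let r = chain-ranges c M n b ℓ i x (⇑ 4 h) e₀ in ∧I (≤⇒<suc (∨I₁ (∧E₁ r))) (∧E₂ r))
      (λ i≐ℓ x≐y → ∧I (≤⇒<suc (∨I₂ i≐ℓ)) (rewrite-at (v 0 ∈ˢ H) [] (≐sym x≐y) (↑ 4 y∈H))) ⟫

  extend-increasing : Γ ⊨ Chain H at old → Γ ⊨ Adjunction at adjunction → Γ ⊢ n <ᵗ y →
    Γ ⊨ Increasing at new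
  extend-increasing h a n<y = ∀I λ i → under λ _ → ∀I λ x → under λ _ → ∀I λ j → under λ _ →
    ∀I λ z → under λ _ → under λ e → under λ k → under λ i<j → ⟪ entry-cases (⇑ 7 a) (↑ 2 (un e))
      (λ e₀ → entry-cases (⇑ 8 a) (↑ 2 (un k))
        (λ k₀ → chain-increasing c M n b ℓ i x j z (⇑ 9 h) (↑ 1 e₀) k₀ (↑ 2 (un i<j)))
        (λ _ z≐y → <cong (≐refl x) (≐sym z≐y)
          (<-≤-trans (entry-<′ (↑ 1 e₀)) (<-weaken (↑ 9 n<y)))))
      (λ i≐ℓ _ → entry-cases (⇑ 8 a) (↑ 2 (un k))
        (λ k₀ → <-irrefl (<-≤-trans (<cong (↑ 1 i≐ℓ) (≐refl j) (↑ 2 (un i<j)))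
          (<-weaken (∧E₁ (chain-ranges c M n b ℓ j z (⇑ 9 h) k₀)))))
        (λ j≐ℓ _ → <-irrefl (<cong (↑ 1 i≐ℓ) j≐ℓ (↑ 2 (un i<j))))) ⟫

  extend : Γ ⊨ Chain H at old → Γ ⊨ Adjunction at adjunction → Γ ⊢ n <ᵗ y → Γ ⊢ y ∈ˢ H →
    Γ ⊨ Chain H at new
  extend h a n<y y∈H =
    pair (extend-total h a) (pair (extend-ranges h a y∈H) (extend-increasing h a n<y))

hasChain-intro : ∀ c M n ℓ → (∀ b → Γ ⊨ Chain H at (c ∷ M ∷ n ∷ b ∷ ℓ ∷ [])) →
  Γ ⊨ ∃ⁿ (HasChain H) at (ℓ ∷ [])
hasChain-intro {H = H} c M n ℓ h =
  ∃I bound (∃<I {φ = v 0 <ᵗ v 1} n (≤⇒<suc (≤-intro (M +ᵗ c)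
         (closed (solve 3 (λ n M c → n :+ (M :+ c) := (n :+ M) :+ c) (≐refl _) n M c))))
       (∃<I {φ = v 0 <ᵗ v 2} M (≤⇒<suc (≤-intro (n +ᵗ c)
         (closed (solve 3 (λ n M c → M :+ (n :+ c) := (n :+ M) :+ c) (≐refl _) n M c))))
       (∃<I {φ = v 0 <ᵗ v 3} c (≤⇒<suc (≤-intro (n +ᵗ M) (+comm _ _)))
       (h bound))))
  where
  bound : Term
  bound = ((n +ᵗ M) +ᵗ c) +ᵗ one'

-- Σ⁰₁ induction on the length takes the place of an enumeration of H.
chain-exists : Γ ⊨ Unbounded H at [] → ∀ ℓ → Γ ⊨ ∃ⁿ (HasChain H) at (ℓ ∷ [])
chain-exists {Γ} {H} inf = induction₁ (HasChain H) [] (bounded (HasChain H))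
  (hasChain-intro zero' zero' zero' zero' λ b → pair (∀I λ _ → under λ h → ⟪ ≮zero (un h) ⟫)
    (pair (∀I λ _ → under λ h → ⟪ ≮zero (un h) ⟫) (∀I λ _ → under λ h → ⟪ ≮zero (un h) ⟫)))
  λ ℓ h → ⟪ ∃E h (λ b h₁ → ∃<E h₁ λ n _ h₂ → ∃<E h₂ λ M _ h₃ → ∃<E h₃ λ c _ old →
    -- All entries are below n, so an element above n exceeds the last one without singling it out.
    ∃E (∀E (⇑ 8 inf) n) λ y hy →
    ∃E (adjoin ((n +ᵗ ⟨ ℓ , y ⟩) +ᵗ one') n M c ⟨ ℓ , y ⟩) λ M′ h₄ → ∃E h₄ λ c′ new →
    un (hasChain-intro {H = H} c′ M′ ((n +ᵗ ⟨ ℓ , y ⟩) +ᵗ one') (ℓ +ᵗ one') λ b′ →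
      Extension.extend H c M n b ℓ y c′ M′ b′ (⇑ 3 old) new (↑ 2 (un (fst hy))) (↑ 2 (un (snd hy))))) ⟫

-- Colours

module Colouring (F : ℕ) where

  -- In the environment z, a, b, k: the colour of z occurs only once in [a, b).
  UniqueAt : Formula
  UniqueAt = (v 1 ≤ᵗ v 0) ∧ ∀< (v 2) ((v 2 ≤ᵗ v 0) ⇒ ¬' (v 0 ≐ v 1) ⇒
    ∀< (v 4) ((⟨ v 2 , v 0 ⟩ ∈ˢ F) ⇒ ¬' (⟨ v 1 , v 0 ⟩ ∈ˢ F)))

  -- `UniqueAt` requires a ≤ z; the bound of this quantifier adds z < b.
  HasUnique : Term → Term → Term → Formula
  HasUnique a b k = ∃< (v 1) UniqueAt [ a ∷ b ∷ k ∷ [] ]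

  -- In the environment x, y, q, k, D: the set coded by q relative to D contains
  -- all colours occurring in [x, y).
  ColoursIn : Formula
  ColoursIn = ∀< (v 1) ((v 1 ≤ᵗ v 0) ⇒ ∀< (v 4) ((⟨ v 1 , v 0 ⟩ ∈ˢ F) ⇒ Member (v 0) (v 6) (v 4)))

  TotalBelow : Formula
  TotalBelow = ∀ⁿ (∃ⁿ ((v 0 <ᵗ v 2) ∧ (⟨ v 1 , v 0 ⟩ ∈ˢ F)))

  -- Since z lies outside [x₁, y₁), the colour e does not occur there. The modulus of any colour f
  -- that does occur divides q, which is the modulus of e times q′, and by coprimality it divides
  -- q′.
  colours-shrink : ∀ x y q k D z e q′ x₁ y₁ →
    Γ ⊨ MultipleOfAll at (D ∷ k ∷ []) →
    Γ ⊨ ColoursIn at (x ∷ y ∷ q ∷ k ∷ D ∷ []) →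
    Γ ⊨ UniqueAt at (z ∷ x ∷ y ∷ k ∷ []) → Γ ⊢ e <ᵗ k → Γ ⊢ ⟨ z , e ⟩ ∈ˢ F →
    Γ ⊢ ((e +ᵗ one') *ᵗ D +ᵗ one') *ᵗ q′ ≐ q →
    Γ ⊢ x ≤ᵗ x₁ → Γ ⊢ y₁ ≤ᵗ y → Γ ⊢ (y₁ ≤ᵗ z) ∨ (z <ᵗ x₁) →
    Γ ⊨ ColoursIn at (x₁ ∷ y₁ ∷ q′ ∷ k ∷ D ∷ [])
  colours-shrink x y q k D z e q′ x₁ y₁ hD col uni e<k ze q≐ x≤x₁ y₁≤y out =
    ∀I λ w → under λ w<y₁ → under λ x₁≤w → ∀I λ f → under λ f<k → under λ wf → ⟪ (
      let w<y = <-≤-trans (↑ 3 (un w<y₁)) (↑ 4 y₁≤y)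
          x≤w = ≤trans (↑ 4 x≤x₁) (↑ 2 (un x₁≤w))
          f∈q = un (apply (apply (∀E (apply (apply (∀E (⇑ 4 col) w) w<y) x≤w) f) (↑ 1 (un f<k))) (un wf))
          w≢z = assume λ w≐z → ∨E (↑ 5 out)
            (λ y₁≤z → <-irrefl (<-≤-trans (<cong (↑ 1 w≐z) (≐refl y₁) (↑ 5 (un w<y₁))) y₁≤z))
            (λ z<x₁ → <-irrefl (<-≤-trans z<x₁ (≤-respʳ (↑ 1 w≐z) (↑ 4 (un x₁≤w)))))
          f≢e = assume λ f≐e → ⇒E
            (un (apply (apply (∀E (apply (apply (apply (∀E (snd (⇑ 5 uni)) w) (↑ 1 w<y)) (↑ 1 x≤w)) (↑ 1 w≢z)) e)
                   (↑ 5 e<k)) (↑ 5 ze)))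
            (rewrite-at (⟨ v 1 , v 0 ⟩ ∈ˢ F) (w ∷ []) f≐e (↑ 1 (un wf)))
      in coprime (⇑ 4 hD) (↑ 1 (un f<k)) (↑ 4 e<k) f≢e
           (∣-resp (≐refl _) (≐sym (↑ 4 q≐) ⨾ *comm _ _) f∈q)) ⟫

  -- The halving argument

  UniqueBetween : ℕ → Formula
  UniqueBetween H =
    ∀ⁿ (∀ⁿ (((v 1 ∈ˢ H) ∧ (v 0 ∈ˢ H) ∧ (v 1 <ᵗ v 0)) ⇒ HasUnique (v 1) (v 0) (v 2)))

  module Bound (H : ℕ) (k D c M n b ℓ : Term) where

    record Setting (Γ : List Formula) : Set where
      field
        multiples   : Γ ⊨ MultipleOfAll at (D ∷ k ∷ [])
        positive    : Γ ⊢ zero' <ᵗ D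
        total       : Γ ⊨ TotalBelow at (k ∷ [])
        homogeneous : Γ ⊨ UniqueBetween H at (k ∷ [])
        chain       : Γ ⊨ Chain H at (c ∷ M ∷ n ∷ b ∷ ℓ ∷ [])

    ⇑ˢ : ∀ r → Setting (drop r Δ) → Setting Δ
    ⇑ˢ r s = record { multiples = ⇑ r multiples ; positive = ↑ r positive ; total = ⇑ r total
                    ; homogeneous = ⇑ r homogeneous ; chain = ⇑ r chain }
      where open Setting s

    ps : List Term
    ps = c ∷ M ∷ n ∷ k ∷ D ∷ []

    -- In the environment q, c, M, n, k, D. Indices and entries of the coded sequence are all below
    -- n, which makes the formula bounded and `strong-induction` applicable. The value q = 0 is
    -- excluded because every modulus divides 0.
    Claim : Formula
    Claim = (zero' <ᵗ v 0) ⇒ ∀< (v 3) (∀< (v 4) (∀< (v 5) (∀< (v 6)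
      (Entry (v 3) (v 2) (v 5) (v 6) (v 7) ⇒ Entry (v 1) (v 0) (v 5) (v 6) (v 7) ⇒
       ColoursIn [ v 2 ∷ v 0 ∷ v 4 ∷ v 8 ∷ v 9 ∷ [] ] ⇒ (v 1 <ᵗ v 3 +ᵗ v 4)))))

    claim-use : ∀ q i x j y → Γ ⊨ Claim at (q ∷ ps) → Γ ⊢ zero' <ᵗ q →
      Γ ⊢ Entry i x c M n → Γ ⊢ Entry j y c M n → Γ ⊨ ColoursIn at (x ∷ y ∷ q ∷ k ∷ D ∷ []) →
      Γ ⊢ j <ᵗ i +ᵗ q
    claim-use q i x j y h 0<q e f col =
      un (apply (apply (apply (apply (∀E (apply (∀E (apply (∀E (apply (∀E (apply h 0<q) i)
        (entry-< e)) x) (entry-<′ e)) j) (entry-< f)) y) (entry-<′ f)) e) f) (un col))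

    <-from-+ : ∀ {t u w} → Γ ⊢ zero' <ᵗ u → Γ ⊢ t +ᵗ u ≤ᵗ w → Γ ⊢ t <ᵗ w
    <-from-+ 0<u h = ≤⇒< (≤trans (+mono ≤refl (≤-respˡ (zero+ one') (<⇒≤ 0<u))) h)

    positive-factor : ∀ {s t u} → Γ ⊢ zero' <ᵗ u → Γ ⊢ s *ᵗ t ≐ u → Γ ⊢ zero' <ᵗ t
    positive-factor {t = t} 0<u e = ≤-or-> t zero'
      (∨E top ≮zero λ t≐0 → <-irrefl (<cong (≐refl _) (≐sym (↑ 2 e) ⨾ *cong (≐refl _) t≐0 ⨾ *zero _) (↑ 2 0<u)))
      top

    -- The source of the halving: a modulus s + 1 with s > 0 is at least 2.
    double-≤ : ∀ {s t u} → Γ ⊢ zero' <ᵗ s → Γ ⊢ (s +ᵗ one') *ᵗ t ≐ u → Γ ⊢ t +ᵗ t ≤ᵗ u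
    double-≤ {t = t} 0<s e = positive-elim 0<s λ r hr → ≤-intro (r *ᵗ t)
      (closed (solve 2 (λ r t → (t :+ t) :+ r :* t := ((r :+ con 1) :+ con 1) :* t) (≐refl _) r t)
       ⨾ *cong (suc-cong hr) (≐refl t) ⨾ ↑ 1 e)

    -- The interval [x, y) is cut at the entry with index i + q′.
    claim-split : ∀ q i x j y z e q′ → Setting Γ →
      Γ ⊨ ∀< (v 0) (shiftN 1 Claim) at (q ∷ ps) → Γ ⊢ zero' <ᵗ q →
      Γ ⊢ Entry i x c M n → Γ ⊢ Entry j y c M n → Γ ⊨ ColoursIn at (x ∷ y ∷ q ∷ k ∷ D ∷ []) →
      Γ ⊢ i +ᵗ q ≤ᵗ j →
      Γ ⊨ UniqueAt at (z ∷ x ∷ y ∷ k ∷ []) → Γ ⊢ e <ᵗ k → Γ ⊢ ⟨ z , e ⟩ ∈ˢ F →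
      Γ ⊢ ((e +ᵗ one') *ᵗ D +ᵗ one') *ᵗ q′ ≐ q → Γ ⊢ ⊥'
    claim-split {Γ} q i x j y z e q′ s ih 0<q ix jy col i+q≤j uni e<k ze q≐ =
      chain-total c M n b ℓ r chain r<ℓ λ x′ rx′ →
        let x<x′ = chain-increasing c M n b ℓ i x r x′ (⇑ 2 chain) (↑ 2 ix) rx′ (↑ 2 i<r)
            x′<y = chain-increasing c M n b ℓ r x′ j y (⇑ 2 chain) rx′ (↑ 2 jy) (↑ 2 r<j)
        -- If x′ ≤ z, the left part [x, x′) misses z and the induction hypothesis gives r < i + q′ =
        -- r. Otherwise the right part [x′, y) misses z and it gives j < r + q′ ≤ j.
        in ≤-or-> x′ z
          (<-irrefl (claim-use q′ i x r x′ (⇑ 3 ih′) (↑ 3 0<q′) (↑ 3 ix) (↑ 1 rx′)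
            (colours-shrink x y q k D z e q′ x x′ (⇑ 3 multiples) (⇑ 3 col) (⇑ 3 uni) (↑ 3 e<k) (↑ 3 ze)
              (↑ 3 q≐) ≤refl (<-weaken (↑ 1 x′<y)) (∨I₁ top))))
          (<-irrefl (<-≤-trans (claim-use q′ r x′ j y (⇑ 3 ih′) (↑ 3 0<q′) (↑ 1 rx′) (↑ 3 jy)
            (colours-shrink x y q k D z e q′ x′ y (⇑ 3 multiples) (⇑ 3 col) (⇑ 3 uni) (↑ 3 e<k) (↑ 3 ze)
              (↑ 3 q≐) (<-weaken (↑ 1 x<x′)) ≤refl (∨I₂ top))) (↑ 3 r+q′≤j)))
      where
      open Setting s
      r : Term
      r = i +ᵗ q′
      0<q′ : Γ ⊢ zero' <ᵗ q′
      0<q′ = positive-factor 0<q q≐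
      2q′≤q : Γ ⊢ q′ +ᵗ q′ ≤ᵗ q
      2q′≤q = double-≤ (<-≤-trans positive (≤-intro (e *ᵗ D)
        (closed (solve 2 (λ D e → D :+ e :* D := (e :+ con 1) :* D) (≐refl _) D e)))) q≐
      ih′ : Γ ⊨ Claim at (q′ ∷ ps)
      -- Both sides compute to the same formula; unwrapping and wrapping only changes the recorded
      -- `φ` and `ts`.
      ih′ = ⟪ un (apply (∀E ih q′) (<-from-+ 0<q′ 2q′≤q)) ⟫
      i<r : Γ ⊢ i <ᵗ r
      i<r = <-from-+ 0<q′ ≤refl
      r+q′≤j : Γ ⊢ r +ᵗ q′ ≤ᵗ j
      r+q′≤j = ≤trans (≤-respˡ (≐sym (+assoc _ _ _)) (+mono ≤refl 2q′≤q)) i+q≤j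
      r<j : Γ ⊢ r <ᵗ j
      r<j = <-from-+ 0<q′ r+q′≤j
      r<ℓ : Γ ⊢ r <ᵗ ℓ
      r<ℓ = <-≤-trans r<j (<-weaken (∧E₁ (chain-ranges c M n b ℓ j y chain jy)))

    -- As q > 0, the indices give x < y, so homogeneity provides a z with a unique colour e. This
    -- colour is in the set coded by q, so its modulus divides q, and the quotient is the q′ of the
    -- split.
    claim-contradiction : ∀ q i x j y → Setting Γ →
      Γ ⊨ ∀< (v 0) (shiftN 1 Claim) at (q ∷ ps) → Γ ⊢ zero' <ᵗ q →
      Γ ⊢ Entry i x c M n → Γ ⊢ Entry j y c M n → Γ ⊨ ColoursIn at (x ∷ y ∷ q ∷ k ∷ D ∷ []) →
      Γ ⊢ i +ᵗ q ≤ᵗ j → Γ ⊢ ⊥'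
    claim-contradiction q i x j y s ih 0<q ix jy col i+q≤j =
      ∃<E {φ = v 0 <ᵗ v 2} {UniqueAt} {x ∷ y ∷ k ∷ []}
        ⟪ un (apply (∀E (∀E homogeneous x) y) (∧I x∈H (∧I y∈H x<y))) ⟫ λ z z<y uni →
      ∃E (∀E (⇑ 2 total) z) λ e he →
      ∣-elim (un (apply (apply (∀E (apply (apply (∀E (⇑ 3 col) z) (↑ 1 z<y)) (↑ 1 (un (fst uni)))) e)
        (un (fst he))) (un (snd he)))) λ q′ q≐ →
      claim-split q i x j y z e q′ (⇑ˢ 5 s) (⇑ 5 ih) (↑ 5 0<q) (↑ 5 ix) (↑ 5 jy) (⇑ 5 col) (↑ 5 i+q≤j)
        (⇑ 3 uni) (↑ 2 (un (fst he))) (↑ 2 (un (snd he))) q≐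
      where
      open Setting s
      x∈H = ∧E₂ (chain-ranges c M n b ℓ i x chain ix)
      y∈H = ∧E₂ (chain-ranges c M n b ℓ j y chain jy)
      x<y = chain-increasing c M n b ℓ i x j y chain ix jy (<-from-+ 0<q i+q≤j)

    claim : Setting Γ → ∀ q → Γ ⊨ Claim at (q ∷ ps)
    claim s = strong-induction Claim ps (bounded Claim) λ q ih →
      under λ 0<q → ∀I λ i → under λ _ → ∀I λ x → under λ _ → ∀I λ j → under λ _ → ∀I λ y → under λ _ →
      under λ ix → under λ jy → under λ col → ⟪ ≤-or-> (i +ᵗ q) j
        (⊥E (claim-contradiction q i x j y (⇑ˢ 10 s) (⇑ 9 ih) (↑ 8 (un 0<q)) (↑ 3 (un ix)) (↑ 2 (un jy))
          ⟪ ↑ 1 (un col) ⟫ top))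
        top ⟫

  no-unique-between : ∀ H k → Γ ⊨ TotalBelow at (k ∷ []) → Γ ⊨ UniqueBetween H at (k ∷ []) →
    Γ ⊨ Unbounded H at [] → Γ ⊢ ⊥'
  no-unique-between H k total hom inf =
    ∃E (multiple-of-all k) λ D hD → ∃E (common-multiple D D k) λ q hq →
    -- Length q + 1 makes both 0 and q indices of the sequence; the claim for these two reads q < 0
    -- + q.
    ∃E (chain-exists (⇑ 2 inf) (q +ᵗ one')) λ b h₁ →
    ∃<E h₁ λ n _ h₂ → ∃<E h₂ λ M _ h₃ → ∃<E h₃ λ c _ chain →
    let open Bound H k D c M n b (q +ᵗ one')
        s = record { multiples = ⇑ 8 (snd hD) ; positive = ↑ 8 (un (fst hD)) ; total = ⇑ 9 total
                   ; homogeneous = ⇑ 9 hom ; chain = chain }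
        0<q = ↑ 7 (un (fst hq))
    in chain-total c M n b (q +ᵗ one') zero' chain (≤⇒<suc (<-weaken 0<q)) λ x ix →
       chain-total c M n b (q +ᵗ one') q (⇑ 2 chain) (≤⇒<suc ≤refl) λ y jy →
       <-irrefl (<cong (≐refl q) (zero+ q) (claim-use q zero' x q y (⇑ 4 (claim s q)) (↑ 4 0<q) (↑ 2 ix) jy
         (∀I λ z → under λ _ → under λ _ → ∀I λ e → under λ e<k → under λ _ →
           ⟪ ∣-resp (closed (solve 2 (λ D e → e :* D :+ D := (e :+ con 1) :* D) (≐refl _) D e)) (≐refl q)
               (un (apply (∀E (⇑ 15 (snd hq)) e) (↑ 1 (un e<k)))) ⟫)))

-- Set existence

∃ˢE : Γ ⊢ ∃ˢ φ → (φ ∷ map (shiftS 0) Γ) ⊢ ⊥' → Γ ⊢ ⊥'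
∃ˢE d e = ⇒E d (∀ˢI (⇒I e))

-- Under a vacuous quantifier of either kind a bounded formula becomes Σ⁰₁ and Π⁰₁, which is the
-- form that `comp` demands.
comprehension₀ : ∀ θ → Σ⁰₀ θ → Γ ⊢ ∃ˢ (∀ⁿ ((v 0 ∈ˢ 0) ⇔ shiftS 0 (∃ⁿ (shiftN 0 θ))))
comprehension₀ {Γ} θ b = ⇒E (ax (comp (σ (Σ⁰₀-shift 0 b)) (π (Σ⁰₀-shift 0 b))))
  (coerce (subF-id _) (un equivalent))
  where
  equivalent : Γ ⊨ ∀ⁿ (∃ⁿ (shiftN 0 θ) ⇔ ∀ⁿ (shiftN 0 θ)) at []
  equivalent = ∀I λ x → ⟪ ⇔I
    (λ h → un (∀I {φ = shiftN 0 θ} {x ∷ []} λ y →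
      ⟪ coerce (sym (shiftN-[] θ y (x ∷ []))) (un (∃-vacuousE θ (x ∷ []) ⟪ h ⟫)) ⟫))
    (λ h → un (∃I {φ = shiftN 0 θ} {x ∷ []} zero' (∀E ⟪ h ⟫ zero'))) ⟫

-- The colouring of pairs

-- `RepeatingTail` with its set variable as a parameter, because the index of F grows with every set
-- introduced later.
Repeating : ℕ → Formula
Repeating F = ∃ⁿ (∀ⁿ ((v 1 ≤ᵗ v 0) ⇒
  ∃ⁿ ((v 2 ≤ᵗ v 0) ∧ ¬' (v 1 ≐ v 0) ∧ ∃ⁿ ((⟨ v 2 , v 0 ⟩ ∈ˢ F) ∧ (⟨ v 1 , v 0 ⟩ ∈ˢ F)))))

module Pairs (F : ℕ) where
  open Colouring F

  -- In the environment m, k: m = ((a, b), c), where c is 1 or 0 according to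
  -- whether [a, b) has a uniquely occurring colour.
  Graph : Formula
  Graph = ∃< (v 0 +ᵗ one') (∃< (v 1 +ᵗ one')
    (((v 2 ≐ ⟨ ⟨ v 1 , v 0 ⟩ , one' ⟩) ∧ HasUnique (v 1) (v 0) (v 3))
     ∨ ((v 2 ≐ ⟨ ⟨ v 1 , v 0 ⟩ , zero' ⟩) ∧ ¬' (HasUnique (v 1) (v 0) (v 3)))))

  DefinedBy : ℕ → Formula
  DefinedBy G = ∀ⁿ ((v 0 ∈ˢ G) ⇔ ∃ⁿ (shiftN 0 Graph))

  hasUnique-resp : ∀ {a a′ b b′ k} → Γ ⊢ a ≐ a′ → Γ ⊢ b ≐ b′ → Γ ⊢ HasUnique a b k → Γ ⊢ HasUnique a′ b′ k
  hasUnique-resp {a = a} {a′} {b} {b′} {k} d e h =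
    rewrite-at (HasUnique (v 1) (v 0) (v 2)) (a′ ∷ k ∷ []) e
      (rewrite-at (HasUnique (v 0) (v 1) (v 2)) (b ∷ k ∷ []) d h)

  module _ (G : ℕ) (k : Term) where

    graph-elim : ∀ a b c → Γ ⊨ DefinedBy G at (k ∷ []) → Γ ⊢ ⟨ ⟨ a , b ⟩ , c ⟩ ∈ˢ G →
      Γ ⊢ ((c ≐ one') ∧ HasUnique a b k) ∨ ((c ≐ zero') ∧ ¬' (HasUnique a b k))
    graph-elim a b c def h =
      ∃<E (∃-vacuousE Graph (abc ∷ k ∷ []) ⟪ ⇔E₁ (un (∀E def abc)) h ⟫) λ a′ _ h₁ →
      ∃<E h₁ λ b′ _ h₂ → ∨E (un h₂)
        (λ p → let e = ∧E₁ p
                   e′ = pair-injectiveˡ ⟨ a , b ⟩ c ⟨ a′ , b′ ⟩ one' e in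
          ∨I₁ (∧I (pair-injectiveʳ ⟨ a , b ⟩ c ⟨ a′ , b′ ⟩ one' e)
                  (hasUnique-resp (≐sym (pair-injectiveˡ a b a′ b′ e′)) (≐sym (pair-injectiveʳ a b a′ b′ e′)) (∧E₂ p))))
        (λ p → let e = ∧E₁ p
                   e′ = pair-injectiveˡ ⟨ a , b ⟩ c ⟨ a′ , b′ ⟩ zero' e in
          ∨I₂ (∧I (pair-injectiveʳ ⟨ a , b ⟩ c ⟨ a′ , b′ ⟩ zero' e)
                  (assume λ u → ⇒E (↑ 1 (∧E₂ p))
                    (hasUnique-resp (↑ 1 (pair-injectiveˡ a b a′ b′ e′)) (↑ 1 (pair-injectiveʳ a b a′ b′ e′)) u))))
      where
      abc : Term
      abc = ⟨ ⟨ a , b ⟩ , c ⟩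

    graph-intro : ∀ a b c → Γ ⊨ DefinedBy G at (k ∷ []) →
      Γ ⊢ ((⟨ ⟨ a , b ⟩ , c ⟩ ≐ ⟨ ⟨ a , b ⟩ , one' ⟩) ∧ HasUnique a b k)
          ∨ ((⟨ ⟨ a , b ⟩ , c ⟩ ≐ ⟨ ⟨ a , b ⟩ , zero' ⟩) ∧ ¬' (HasUnique a b k)) →
      Γ ⊢ ⟨ ⟨ a , b ⟩ , c ⟩ ∈ˢ G
    graph-intro a b c def h = ⇔E₂ (un (∀E def abc)) (un (∃-vacuousI Graph (abc ∷ k ∷ [])
      (∃<I a (≤⇒<suc (≤trans (≤-pairˡ a b) (≤-pairˡ ⟨ a , b ⟩ c)))
      (∃<I b (≤⇒<suc (≤trans (≤-pairʳ a b) (≤-pairˡ ⟨ a , b ⟩ c)))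
      ⟪ h ⟫))))
      where
      abc : Term
      abc = ⟨ ⟨ a , b ⟩ , c ⟩

    graph-one : ∀ a b → Γ ⊨ DefinedBy G at (k ∷ []) → Γ ⊢ HasUnique a b k →
      Γ ⊢ ⟨ ⟨ a , b ⟩ , one' ⟩ ∈ˢ G
    graph-one a b def h = graph-intro a b one' def (∨I₁ (∧I (≐refl _) h))

    graph-zero : ∀ a b → Γ ⊨ DefinedBy G at (k ∷ []) → Γ ⊢ ¬' (HasUnique a b k) →
      Γ ⊢ ⟨ ⟨ a , b ⟩ , zero' ⟩ ∈ˢ G
    graph-zero a b def h = graph-intro a b zero' def (∨I₂ (∧I (≐refl _) h))

    -- If the tail from `a` on is not repeating, some x ≥ a shares its colour with no other y ≥ a;
    -- this one x witnesses uniqueness for all b > x.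
    limit : ∀ a → Γ ⊢ ¬' (Repeating F) →
      Γ ⊨ ∃ⁿ (∀ⁿ ((v 1 <ᵗ v 0) ⇒ HasUnique (v 2) (v 0) (v 3))) at (a ∷ k ∷ [])
    limit {Γ} a nr = ⟪ by-contra (λ none → ⇒E (↑ 1 nr) (un (∃I {φ = tail} {[]} a
      (∀I λ x → under λ a≤x → ⟪ by-contra (λ nx → ⇒E (↑ 2 none)
        (un (∃I {φ = later} {a ∷ k ∷ []} x (∀I λ b → under λ x<b → ⟪
          un (∃<I {φ = v 0 <ᵗ v 2} {a ∷ b ∷ k ∷ []} {UniqueAt} x (un x<b)
            (pair ⟪ ↑ 2 (un a≤x) ⟫ (∀I λ w → under λ _ → under λ a≤w → under λ w≢x →
              ∀I λ e → under λ _ → under λ xe → under λ we → ⟪ ⇒E (↑ 7 nx)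
                (un (∃I {φ = other} {x ∷ a ∷ []} w
                  (pair ⟪ ↑ 4 (un a≤w) ⟫ (pair ⟪ assume (λ x≐w → ⇒E (↑ 4 (un w≢x)) (≐sym x≐w)) ⟫
                    (∃I e (pair ⟪ ↑ 1 (un xe) ⟫ ⟪ un we ⟫)))))) ⟫))) ⟫)))) ⟫)))) ⟫
      where
      other tail later : Formula
      other = (v 2 ≤ᵗ v 0) ∧ ¬' (v 1 ≐ v 0) ∧ ∃ⁿ ((⟨ v 2 , v 0 ⟩ ∈ˢ F) ∧ (⟨ v 1 , v 0 ⟩ ∈ˢ F))
      tail = ∀ⁿ ((v 1 ≤ᵗ v 0) ⇒ ∃ⁿ other)
      later = ∀ⁿ ((v 1 <ᵗ v 0) ⇒ HasUnique (v 2) (v 0) (v 3))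

-- Applying stable Ramsey's theorem to the colouring

one<two : Γ ⊢ one' <ᵗ num 2
one<two = ≤⇒<suc (≤-respʳ (≐sym (zero+ one')) ≤refl)

zero<two : Γ ⊢ zero' <ᵗ num 2
zero<two = ≤⇒<suc (≤-intro (zero' +ᵗ one') (zero+ _))

one≢zero : Γ ⊢ one' ≐ zero' → Γ ⊢ ψ
one≢zero e = suc≢zero (zero+ one' ⨾ e)

module _ (F : ℕ) (k : Term) where
  open Colouring F
  open Pairs F

  colouring2 : Γ ⊨ DefinedBy 0 at (k ∷ []) → Γ ⊨ Colouring2 at []
  colouring2 def = pair
    (∀I λ a → ∀I λ b → under λ _ → ⟪ by-cases (HasUnique a b k)
      (λ h → un (∃I {φ = colour} {b ∷ a ∷ []} one' ⟪ ∧I one<two (graph-one 0 k a b (⇑ 2 def) h) ⟫))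
      (λ h → un (∃I {φ = colour} {b ∷ a ∷ []} zero' ⟪ ∧I zero<two (graph-zero 0 k a b (⇑ 2 def) h) ⟫)) ⟫)
    (∀I λ a → ∀I λ b → ∀I λ c → ∀I λ d → under λ h → ⟪
      ∨E (graph-elim 0 k a b c (⇑ 1 def) (∧E₁ (un h)))
        (λ p → ∨E (graph-elim 0 k a b d (⇑ 2 def) (∧E₂ (↑ 1 (un h))))
          (λ q → ∧E₁ (↑ 1 p) ⨾ ≐sym (∧E₁ q))
          (λ q → absurd (∧E₂ q) (∧E₂ (↑ 1 p))))
        (λ p → ∨E (graph-elim 0 k a b d (⇑ 2 def) (∧E₂ (↑ 1 (un h))))
          (λ q → absurd (∧E₂ (↑ 1 p)) (∧E₂ q))
          (λ q → ∧E₁ (↑ 1 p) ⨾ ≐sym (∧E₁ q))) ⟫)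
    where
    colour : Formula
    colour = (v 0 <ᵗ num 2) ∧ (⟨ ⟨ v 2 , v 1 ⟩ , v 0 ⟩ ∈ˢ 0)

  stable : Γ ⊨ DefinedBy 0 at (k ∷ []) → Γ ⊢ ¬' (Repeating F) → Γ ⊨ Stable at []
  stable def nr = ∀I λ a → ⟪ ∃E (limit 0 k a nr) (λ x hx →
    un (∃I {φ = ∃ⁿ constant} {a ∷ []} one' (∃I {φ = constant} x (∀I λ b → under λ h →
      ⟪ graph-one 0 k a b (⇑ 2 def) (un (apply (∀E (⇑ 1 hx) b) (∧E₁ (un h)))) ⟫)))) ⟫
    where
    constant : Formula
    constant = ∀ⁿ (((v 1 <ᵗ v 0) ∧ (v 3 <ᵗ v 0)) ⇒ (⟨ ⟨ v 3 , v 0 ⟩ , v 2 ⟩ ∈ˢ 0))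

  -- The colour c of the homogeneous set is not given. One pair of H settles it: for a in H and b in
  -- H beyond the point where the colouring of a has reached its limit, the colour is 1, so c = 1
  -- for all pairs.
  unique-between : Γ ⊨ DefinedBy 1 at (k ∷ []) → Γ ⊢ ¬' (Repeating F) → Γ ⊨ Infinite at [] →
    Γ ⊨ Homogeneous at [] → Γ ⊨ UniqueBetween 0 at (k ∷ [])
  unique-between def nr inf hom = ∀I λ a′ → ∀I λ b′ → under λ h′ → ⟪
    ∃E (⇑ 1 hom) (λ c hc →
    ∃E (∀E (⇑ 2 inf) zero') λ a ha → ∃E (limit 1 k a (↑ 3 nr)) λ x hx →
    -- The sum a + x bounds both, so a single element of H lies beyond a and beyond x.
    ∃E (∀E (⇑ 4 inf) (a +ᵗ x)) λ b hb →
    let a<b = ≤-<-trans (≤-intro x (≐refl _)) (un (fst hb))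
        x<b = ≤-<-trans (≤-intro a (+comm x a)) (un (fst hb))
        u   = un (apply (∀E (⇑ 1 hx) b) x<b)
        g   = un (apply (∀E (∀E (snd (⇑ 3 hc)) a) b) (∧I (↑ 2 (un (snd ha))) (∧I (un (snd hb)) a<b)))
        c≐1 = ∨E (graph-elim 1 k a b c (⇑ 5 def) g) ∧E₁ (λ p → absurd (∧E₂ p) (↑ 1 u))
    in ∨E (graph-elim 1 k a′ b′ c (⇑ 5 def) (un (apply (∀E (∀E (snd (⇑ 3 hc)) a′) b′) (↑ 4 (un h′)))))
         ∧E₂ (λ p → one≢zero (≐sym (↑ 1 c≐1) ⨾ ∧E₁ p))) ⟫

theorem16 : RCA₀⊢ (SRT²₂ ⇒ ERT)
theorem16 = ⇒I (∀ⁿI (∀ˢI (⇒I (raa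
  (∃ˢE (comprehension₀ (Pairs.Graph 0) (bounded (Pairs.Graph 0)))
    (∃ˢE (⇒E (∀ˢE (↑ 3 top) 0)
             (∧I (un (colouring2 1 (v 0) ⟪ top ⟫)) (un (stable 1 (v 0) ⟪ top ⟫ (↑ 1 top)))))
      -- With both sets introduced, the set variables are H = 0, G = 1 and F = 2, and k is still
      -- `v 0`.
      (Colouring.no-unique-between 2 0 (v 0) ⟪ ∧E₁ (↑ 3 top) ⟫
        (unique-between 2 (v 0) ⟪ ↑ 1 top ⟫ (↑ 2 top) ⟪ ∧E₁ top ⟫ ⟪ ∧E₂ top ⟫)
        ⟪ ∧E₁ top ⟫)))))))
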